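{- Let $f:X+U\to U+Y$ be a terminating arrow of a countably lextensive category $\mathfrak E$. Let $\mathbf X$ be the $N$-automaton in $\mathfrak E$ with state space $X+Y$ given by the loop $$X+Y\xrightarrow{(\mathbf{call}[f]\,\mid\,\mathbf 1_Y)}Y\xrightarrow{\mathrm{inj}_2^{X,Y}}X+Y,$$ and let $\mathbf X'$ be the $N$-automaton with state space $X+U+Y$ given by the loop $$h:X+U+Y\xrightarrow{(f\,\mid\,\mathrm{inj}_2^{U,Y})}U+Y\xrightarrow{\mathrm{inj}_2^{X,U+Y}}X+U+Y$$ (the functional processor induced by $f$). Then there is a refinement from $\mathbf X$ to $\mathbf X'$ whose object component is the inclusion $F_0:X+Y\to X+U+Y$.
   Context: A category with countable sums is countably extensive if, for countable families, the canonical functor $\prod_i\mathfrak E/A_i\to\mathfrak E/\sum_iA_i$ is an equivalence; countably lextensive means countably extensive with finite limits. In such a category any $g:C\to A+B$ is the sum of its pullbacks $g_{\lceil A}:g^{ -1}(A)\to A$ and $g_{B\rceil}:g^{ -1}(B)\to B$ along the injections, with $C\cong g^{ -1}(A)+g^{ -1}(B)$. For $f:X+U\to U+Y$ let $f_0=f_{|X}:X\to U+Y$ and $f_{k+1}=f_{|U}\circ f_{k\lceil U}:f_k^{ -1}(U)\to U+Y$ (restrictions along injections). $f$ is terminating if the injections $f_k^{ -1}(Y)\to X$ induce an isomorphism $\sum_{k\ge0}f_k^{ -1}(Y)\cong X$; then $\mathbf{call}[f]:X\to Y$ is given on $f_k^{ -1}(Y)$ by $f_{kY\rceil}$. $I$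 is the terminal object and $N=I+I+\cdots$ (countable sum) is the free monoid on $I$ (natural numbers under addition). A loop $g:Z\to Z$ defines an $N$-automaton with state space $Z$ and monoid action $\alpha:N\times Z\cong Z+Z+\cdots\xrightarrow{(\mathbf 1_Z\mid g\mid g^2\mid\cdots)}Z$. For a monoid $\langle M,\mu,\varepsilon\rangle$ in $\mathfrak E$ and an automaton $Z$ on $M$ with action $\alpha:M\times Z\to Z$, the transition category $\mathbf{Trans}(Z)$ is the internal category of $\mathfrak E$ with object of objects $Z$, object of arrows $M\times Z$, domain $\partial_0=\mathrm{proj}_2$, codomain $\partial_1=\alpha$, identity $Z\to M\times Z$ given by $(\varepsilon\circ{!},\mathbf 1_Z)$ with $!:Z\to I$ the terminal map, and composition on the object of composable pairs given, in terms of elements, by $(m',m\cdot z),(m,z)\mapsto(m'm,z)$. A refinement from an automaton $Z$ to an automaton $Z'$ in $\mathfrak E$ is an internal functor $F=(F_0,F_1):\mathbf{Trans}(Z)\to\mathbf{Trans}(Z')$ (with $F_0$ on objects of objects, $F_1$ on objects of arrows) which is a full inclusion, i.e.: $F_0$ is mono (injective on objects), $F_1$ is mono (faithful), and $F$ is full, meaning that the factorization of $F_1$ through $\partial_0^{ -1}(F_0)\cap\partial_1^{ -1}(F_0)$ is an epi. Here $\partial_q^{ -1}(F_0)$ denotes the pullback of $F_0$ along the arrow $\partial_q$ of $\mathbf{Trans}(Z')$ ($q=0,1$), and $\partial_0^{ -1}(F_0)\cap\partial_1^{ -1}(F_0)$ is the pullback of $\partial_0^{ -1}(F_0)$ and $\partial_1^{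 -1}(F_0)$ over the object of arrows of $\mathbf{Trans}(Z')$. -}

module Defs where

open import Level using (Level; _⊔_) renaming (suc to lsuc)
open import Data.Fin using (Fin; zero; suc)
open import Data.Nat using (ℕ; zero; suc) renaming (_+_ to _+ℕ_)
import Data.Nat.Properties as ℕₚ
import Relation.Binary.PropositionalEquality as ≡
open ≡ using (_≡_)
open import Relation.Binary using (Rel; IsEquivalence; Setoid)
import Relation.Binary.Reasoning.Setoid as SetoidReasoning


record Category (o ℓ e : Level) : Set (lsuc (o ⊔ ℓ ⊔ e)) where
  infix  4 _⇒_ _≈_
  infixr 9 _∘_
  field
    Obj : Set o
    _⇒_ : Obj → Obj → Set ℓ
    _≈_ : ∀ {A B} → Rel (A ⇒ B) e
    id  : ∀ {A} → A ⇒ A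
    _∘_ : ∀ {A B C} → B ⇒ C → A ⇒ B → A ⇒ C

    equiv     : ∀ {A B} → IsEquivalence (_≈_ {A} {B})
    ∘-resp-≈  : ∀ {A B C} {g g′ : B ⇒ C} {f f′ : A ⇒ B} →
                g ≈ g′ → f ≈ f′ → g ∘ f ≈ g′ ∘ f′
    assoc     : ∀ {A B C D} {h : C ⇒ D} {g : B ⇒ C} {f : A ⇒ B} →
                (h ∘ g) ∘ f ≈ h ∘ (g ∘ f)
    identityˡ : ∀ {A B} {f : A ⇒ B} → id ∘ f ≈ f
    identityʳ : ∀ {A B} {f : A ⇒ B} → f ∘ id ≈ f

  hom-setoid : Obj → Obj → Setoid ℓ e
  hom-setoid A B = record { Carrier = A ⇒ B ; _≈_ = _≈_ ; isEquivalence = equiv }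

  ≈-refl : ∀ {A B} {f : A ⇒ B} → f ≈ f
  ≈-refl = IsEquivalence.refl equiv

  ≈-sym : ∀ {A B} {f g : A ⇒ B} → f ≈ g → g ≈ f
  ≈-sym = IsEquivalence.sym equiv

  ≈-trans : ∀ {A B} {f g h : A ⇒ B} → f ≈ g → g ≈ h → f ≈ h
  ≈-trans = IsEquivalence.trans equiv

  module HomReasoning {A B : Obj} = SetoidReasoning (hom-setoid A B)

  infixr 4 _⟩∘_ _∘⟨_

  _⟩∘_ : ∀ {A B C} {g g′ : B ⇒ C} → g ≈ g′ → (f : A ⇒ B) → g ∘ f ≈ g′ ∘ f
  p ⟩∘ _ = ∘-resp-≈ p ≈-refl

  _∘⟨_ : ∀ {A B C} (g : B ⇒ C) {f f′ : A ⇒ B} → f ≈ f′ → g ∘ f ≈ g ∘ f′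
  _ ∘⟨ p = ∘-resp-≈ ≈-refl p

  pullˡ : ∀ {A B C D} {h : C ⇒ D} {g : B ⇒ C} {k : B ⇒ D} {f : A ⇒ B} →
          h ∘ g ≈ k → h ∘ (g ∘ f) ≈ k ∘ f
  pullˡ p = ≈-trans (≈-sym assoc) (p ⟩∘ _)

  pullʳ : ∀ {A B C D} {h : C ⇒ D} {g : B ⇒ C} {f : A ⇒ B} {k : A ⇒ C} →
          g ∘ f ≈ k → (h ∘ g) ∘ f ≈ h ∘ k
  pullʳ p = ≈-trans assoc (_ ∘⟨ p)

  Mono : ∀ {A B} → A ⇒ B → Set (o ⊔ ℓ ⊔ e)
  Mono {A} f = ∀ {T} (g h : T ⇒ A) → f ∘ g ≈ f ∘ h → g ≈ h

  Epi : ∀ {A B} → A ⇒ B → Set (o ⊔ ℓ ⊔ e)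
  Epi {B = B} f = ∀ {T} (g h : B ⇒ T) → g ∘ f ≈ h ∘ f → g ≈ h

  record IsIso {A B : Obj} (f : A ⇒ B) : Set (ℓ ⊔ e) where
    field
      inv  : B ⇒ A
      isoˡ : inv ∘ f ≈ id
      isoʳ : f ∘ inv ≈ id

record Functor {o ℓ e o′ ℓ′ e′}
               (C : Category o ℓ e) (D : Category o′ ℓ′ e′) :
               Set (o ⊔ ℓ ⊔ e ⊔ o′ ⊔ ℓ′ ⊔ e′) where
  private
    module C = Category C
    module D = Category D
  field
    F₀ : C.Obj → D.Obj
    F₁ : ∀ {A B} → A C.⇒ B → F₀ A D.⇒ F₀ B
    F-resp-≈     : ∀ {A B} {f g : A C.⇒ B} → f C.≈ g → F₁ f D.≈ F₁ g
    identity     : ∀ {A} → F₁ (C.id {A}) D.≈ D.id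
    homomorphism : ∀ {A B C} {g : B C.⇒ C} {f : A C.⇒ B} →
                   F₁ (g C.∘ f) D.≈ F₁ g D.∘ F₁ f

idF : ∀ {o ℓ e} {C : Category o ℓ e} → Functor C C
idF {C = C} = record
  { F₀ = λ A → A
  ; F₁ = λ f → f
  ; F-resp-≈ = λ p → p
  ; identity = ≈-refl
  ; homomorphism = ≈-refl
  } where open Category C

infixr 9 _∘F_

_∘F_ : ∀ {o ℓ e o′ ℓ′ e′ o″ ℓ″ e″}
       {C : Category o ℓ e} {D : Category o′ ℓ′ e′} {E : Category o″ ℓ″ e″} →
       Functor D E → Functor C D → Functor C E
_∘F_ {E = E} G F = record
  { F₀ = λ A → G.F₀ (F.F₀ A)
  ; F₁ = λ f → G.F₁ (F.F₁ f)
  ; F-resp-≈ = λ p → G.F-resp-≈ (F.F-resp-≈ p)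
  ; identity = ≈-trans (G.F-resp-≈ F.identity) G.identity
  ; homomorphism = ≈-trans (G.F-resp-≈ F.homomorphism) G.homomorphism
  } where
    open Category E
    module G = Functor G
    module F = Functor F

record NaturalIsomorphism {o ℓ e o′ ℓ′ e′}
                          {C : Category o ℓ e} {D : Category o′ ℓ′ e′}
                          (F G : Functor C D) :
                          Set (o ⊔ ℓ ⊔ e ⊔ o′ ⊔ ℓ′ ⊔ e′) where
  private
    module C = Category C
    module F = Functor F
    module G = Functor G
  open Category D
  field
    η       : ∀ A → F.F₀ A ⇒ G.F₀ A
    natural : ∀ {A B} (f : A C.⇒ B) → η B ∘ F.F₁ f ≈ G.F₁ f ∘ η A
    iso     : ∀ A → IsIso (η A)

record IsCategoryEquivalence {o ℓ e o′ ℓ′ e′}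
                             {C : Category o ℓ e} {D : Category o′ ℓ′ e′}
                             (F : Functor C D) :
                             Set (o ⊔ ℓ ⊔ e ⊔ o′ ⊔ ℓ′ ⊔ e′) where
  field
    inverse : Functor D C
    unit    : NaturalIsomorphism idF (inverse ∘F F)
    counit  : NaturalIsomorphism (F ∘F inverse) idF

∏ : ∀ {o ℓ e} {I : Set} → (I → Category o ℓ e) → Category o ℓ e
∏ C = record
  { Obj = ∀ i → Category.Obj (C i)
  ; _⇒_ = λ A B → ∀ i → Category._⇒_ (C i) (A i) (B i)
  ; _≈_ = λ f g → ∀ i → Category._≈_ (C i) (f i) (g i)
  ; id  = λ i → Category.id (C i)
  ; _∘_ = λ g f i → Category._∘_ (C i) (g i) (f i)
  ; equiv = record
    { refl  = λ i → Category.≈-refl (C i)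
    ; sym   = λ p i → Category.≈-sym (C i) (p i)
    ; trans = λ p q i → Category.≈-trans (C i) (p i) (q i)
    }
  ; ∘-resp-≈  = λ p q i → Category.∘-resp-≈ (C i) (p i) (q i)
  ; assoc     = λ i → Category.assoc (C i)
  ; identityˡ = λ i → Category.identityˡ (C i)
  ; identityʳ = λ i → Category.identityʳ (C i)
  }

module _ {o ℓ e} (𝔈 : Category o ℓ e) where
  open Category 𝔈

  record SliceObj (A : Obj) : Set (o ⊔ ℓ) where
    constructor sliceobj
    field
      {dom} : Obj
      arr   : dom ⇒ A

  record SliceArr {A : Obj} (P Q : SliceObj A) : Set (ℓ ⊔ e) where
    constructor slicearr
    private
      module P = SliceObj P
      module Q = SliceObj Q
    field
      {hom}    : P.dom ⇒ Q.dom
      triangle : Q.arr ∘ hom ≈ P.arr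

  Slice : Obj → Category (o ⊔ ℓ) (ℓ ⊔ e) e
  Slice A = record
    { Obj = SliceObj A
    ; _⇒_ = SliceArr
    ; _≈_ = λ f g → SliceArr.hom f ≈ SliceArr.hom g
    ; id  = slicearr identityʳ
    ; _∘_ = λ g f → slicearr
              (≈-trans (pullˡ (SliceArr.triangle g)) (SliceArr.triangle f))
    ; equiv = record { refl = ≈-refl ; sym = ≈-sym ; trans = ≈-trans }
    ; ∘-resp-≈  = ∘-resp-≈
    ; assoc     = assoc
    ; identityˡ = identityˡ
    ; identityʳ = identityʳ
    }


module _ {o ℓ e} (𝔈 : Category o ℓ e) where
  open Category 𝔈

  record Coproduct {I : Set} (A : I → Obj) : Set (o ⊔ ℓ ⊔ e) where
    field
      obj    : Obj
      inj    : ∀ i → A i ⇒ obj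
      copair : ∀ {T} → (∀ i → A i ⇒ T) → obj ⇒ T
      copair∘inj : ∀ {T} {f : ∀ i → A i ⇒ T} i → copair f ∘ inj i ≈ f i
      unique : ∀ {T} {f : ∀ i → A i ⇒ T} {h : obj ⇒ T} →
               (∀ i → h ∘ inj i ≈ f i) → h ≈ copair f

  record Terminal : Set (o ⊔ ℓ ⊔ e) where
    field
      ⊤ : Obj
      ! : ∀ {A} → A ⇒ ⊤
      !-unique : ∀ {A} (f : A ⇒ ⊤) → f ≈ !

  record Product (A B : Obj) : Set (o ⊔ ℓ ⊔ e) where
    field
      A×B   : Obj
      π₁    : A×B ⇒ A
      π₂    : A×B ⇒ B
      ⟨_,_⟩ : ∀ {T} → T ⇒ A → T ⇒ B → T ⇒ A×B
      π₁∘⟨⟩ : ∀ {T} {f : T ⇒ A} {g : T ⇒ B} → π₁ ∘ ⟨ f , g ⟩ ≈ f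
      π₂∘⟨⟩ : ∀ {T} {f : T ⇒ A} {g : T ⇒ B} → π₂ ∘ ⟨ f , g ⟩ ≈ g
      unique : ∀ {T} {f : T ⇒ A} {g : T ⇒ B} {h : T ⇒ A×B} →
               π₁ ∘ h ≈ f → π₂ ∘ h ≈ g → h ≈ ⟨ f , g ⟩

  record Pullback {A B C : Obj} (f : A ⇒ C) (g : B ⇒ C) : Set (o ⊔ ℓ ⊔ e) where
    field
      P       : Obj
      p₁      : P ⇒ A
      p₂      : P ⇒ B
      commute : f ∘ p₁ ≈ g ∘ p₂
      universal    : ∀ {T} {h₁ : T ⇒ A} {h₂ : T ⇒ B} → f ∘ h₁ ≈ g ∘ h₂ → T ⇒ P
      p₁∘universal : ∀ {T} {h₁ : T ⇒ A} {h₂ : T ⇒ B} {eq : f ∘ h₁ ≈ g ∘ h₂} →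
                     p₁ ∘ universal eq ≈ h₁
      p₂∘universal : ∀ {T} {h₁ : T ⇒ A} {h₂ : T ⇒ B} {eq : f ∘ h₁ ≈ g ∘ h₂} →
                     p₂ ∘ universal eq ≈ h₂
      unique : ∀ {T} {h₁ : T ⇒ A} {h₂ : T ⇒ B} {eq : f ∘ h₁ ≈ g ∘ h₂} {h : T ⇒ P} →
               p₁ ∘ h ≈ h₁ → p₂ ∘ h ≈ h₂ → h ≈ universal eq

  -- Products and pullbacks are chosen separately; together with the terminal
  -- object they generate all finite limits.
  record FiniteLimits : Set (o ⊔ ℓ ⊔ e) where
    field
      terminal : Terminal
      product  : ∀ A B → Product A B
      pullback : ∀ {A B C} (f : A ⇒ C) (g : B ⇒ C) → Pullback f g

-- "Countable" means finite or countably infinite.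
data Cardinal : Set where
  fin : ℕ → Cardinal
  ω   : Cardinal

El : Cardinal → Set
El (fin n) = Fin n
El ω       = ℕ

CountableSums : ∀ {o ℓ e} → Category o ℓ e → Set (o ⊔ ℓ ⊔ e)
CountableSums 𝔈 = ∀ κ (A : El κ → Category.Obj 𝔈) → Coproduct 𝔈 A

module _ {o ℓ e} {𝔈 : Category o ℓ e} where
  open Category 𝔈

  -- (fᵢ : Bᵢ → Aᵢ)ᵢ  ↦  ∑ᵢ fᵢ : ∑ᵢ Bᵢ → ∑ᵢ Aᵢ
  sumFunctor : (sums : CountableSums 𝔈) → ∀ κ (A : El κ → Obj) →
               Functor (∏ (λ i → Slice 𝔈 (A i)))
                       (Slice 𝔈 (Coproduct.obj (sums κ A)))
  sumFunctor sums κ A = record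
    { F₀ = λ B → sliceobj (total B)
    ; F₁ = λ {B} {B′} f → slicearr {hom = map B B′ f} (triangle B B′ f)
    ; F-resp-≈ = λ {B} {B′} p → ∐.unique B λ i →
        ≈-trans (∐.copair∘inj B i) (∐.inj B′ i ∘⟨ p i)
    ; identity = λ {B} → ≈-sym (∐.unique B λ i →
        ≈-trans identityˡ (≈-sym identityʳ))
    ; homomorphism = λ {B} {B′} {B″} {g} {f} → ≈-sym (∐.unique B λ i →
        ≈-trans (pullʳ (∐.copair∘inj B i))
        (≈-trans (pullˡ (∐.copair∘inj B′ i)) assoc))
    }
    where
      module ∐A = Coproduct (sums κ A)

      Family : Set (o ⊔ ℓ)
      Family = ∀ i → SliceObj 𝔈 (A i)

      module ∐ (B : Family) = Coproduct (sums κ (λ i → SliceObj.dom (B i)))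

      total : (B : Family) → ∐.obj B ⇒ ∐A.obj
      total B = ∐.copair B λ i → ∐A.inj i ∘ SliceObj.arr (B i)

      map : (B B′ : Family) → (∀ i → SliceArr 𝔈 (B i) (B′ i)) → ∐.obj B ⇒ ∐.obj B′
      map B B′ f = ∐.copair B λ i → ∐.inj B′ i ∘ SliceArr.hom (f i)

      triangle : ∀ B B′ f → total B′ ∘ map B B′ f ≈ total B
      triangle B B′ f = ∐.unique B λ i →
        ≈-trans (pullʳ (∐.copair∘inj B i))
        (≈-trans (pullˡ (∐.copair∘inj B′ i))
                 (pullʳ (SliceArr.triangle (f i))))

record CountablyLextensive {o ℓ e} (𝔈 : Category o ℓ e) : Set (lsuc (o ⊔ ℓ ⊔ e)) where
  field
    sums      : CountableSums 𝔈
    extensive : ∀ κ A → IsCategoryEquivalence (sumFunctor sums κ A)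
    limits    : FiniteLimits 𝔈

module _ {o ℓ e o′ ℓ′ e′} {C : Category o ℓ e} {D : Category o′ ℓ′ e′}
         {F : Functor C D} (E : IsCategoryEquivalence F) where
  private
    module C = Category C
    module D = Category D
    module F = Functor F
  open IsCategoryEquivalence E
  private
    module G = Functor inverse
    module η = NaturalIsomorphism unit
    module ε = NaturalIsomorphism counit
    module ηi A = C.IsIso (η.iso A)
    module εi A = D.IsIso (ε.iso A)

  inverse-faithful : ∀ {A B} (h k : A D.⇒ B) → G.F₁ h C.≈ G.F₁ k → h D.≈ k
  inverse-faithful {A} {B} h k p = begin
    h                                    ≈⟨ via h ⟩
    (ε.η B ∘ F.F₁ (G.F₁ h)) ∘ εi.inv A   ≈⟨ (ε.η B ∘⟨ F.F-resp-≈ p) ⟩∘ _ ⟩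
    (ε.η B ∘ F.F₁ (G.F₁ k)) ∘ εi.inv A   ≈⟨ via k ⟨
    k                                    ∎
    where
      open D
      open D.HomReasoning
      via : ∀ (h : A ⇒ B) → h ≈ (ε.η B ∘ F.F₁ (G.F₁ h)) ∘ εi.inv A
      via h = begin
        h                                    ≈⟨ identityʳ ⟨
        h ∘ id                               ≈⟨ h ∘⟨ εi.isoʳ A ⟨
        h ∘ (ε.η A ∘ εi.inv A)               ≈⟨ pullˡ (≈-sym (ε.natural h)) ⟩
        (ε.η B ∘ F.F₁ (G.F₁ h)) ∘ εi.inv A   ∎

  functorPreimage : ∀ {A B} → F.F₀ A D.⇒ F.F₀ B → A C.⇒ B
  functorPreimage {A} {B} h = ηi.inv B C.∘ (G.F₁ h C.∘ η.η A)

  functor-full : ∀ {A B} (h : F.F₀ A D.⇒ F.F₀ B) → F.F₁ (functorPreimage h) D.≈ h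
  functor-full {A} {B} h = inverse-faithful _ _ (begin
    GFv                          ≈⟨ identityʳ ⟨
    GFv ∘ id                     ≈⟨ GFv ∘⟨ ηi.isoʳ A ⟨
    GFv ∘ (η.η A ∘ ηi.inv A)     ≈⟨ pullˡ (≈-sym (η.natural v)) ⟩
    (η.η B ∘ v) ∘ ηi.inv A       ≈⟨ pullˡ (ηi.isoʳ B) ⟩∘ _ ⟩
    (id ∘ (G.F₁ h ∘ η.η A)) ∘ ηi.inv A  ≈⟨ identityˡ ⟩∘ _ ⟩
    (G.F₁ h ∘ η.η A) ∘ ηi.inv A  ≈⟨ pullʳ (ηi.isoʳ A) ⟩
    G.F₁ h ∘ id                  ≈⟨ identityʳ ⟩
    G.F₁ h                       ∎)
    where
      open C
      open C.HomReasoning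
      v : A ⇒ B
      v = functorPreimage h
      GFv = G.F₁ (F.F₁ v)

module Lextensive {o ℓ e} {𝔈 : Category o ℓ e} (L : CountablyLextensive 𝔈) where
  open Category 𝔈
  open CountablyLextensive L
  open FiniteLimits limits
  open Terminal terminal public using (⊤; !; !-unique)

  module ∐ κ (A : El κ → Obj) = Coproduct (sums κ A)
  module ×′ A B = Product (product A B)
  module Pb {A B C} (f : A ⇒ C) (g : B ⇒ C) = Pullback (pullback f g)

  infixr 7 _×_
  infixr 6 _+_

  _×_ : Obj → Obj → Obj
  A × B = ×′.A×B A B

  π₁ : ∀ {A B} → A × B ⇒ A
  π₁ = ×′.π₁ _ _

  π₂ : ∀ {A B} → A × B ⇒ B
  π₂ = ×′.π₂ _ _

  ⟨_,_⟩ : ∀ {A B T} → T ⇒ A → T ⇒ B → T ⇒ A × B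
  ⟨_,_⟩ = ×′.⟨_,_⟩ _ _

  two : Obj → Obj → Fin 2 → Obj
  two A B zero       = A
  two A B (suc zero) = B

  twoArr : ∀ {A B T} → A ⇒ T → B ⇒ T → ∀ i → two A B i ⇒ T
  twoArr f g zero       = f
  twoArr f g (suc zero) = g

  _+_ : Obj → Obj → Obj
  A + B = ∐.obj (fin 2) (two A B)

  inj₁ : ∀ {A B} → A ⇒ A + B
  inj₁ {A} {B} = ∐.inj (fin 2) (two A B) zero

  inj₂ : ∀ {A B} → B ⇒ A + B
  inj₂ {A} {B} = ∐.inj (fin 2) (two A B) (suc zero)

  [_,_] : ∀ {A B T} → A ⇒ T → B ⇒ T → A + B ⇒ T
  [_,_] {A} {B} f g = ∐.copair (fin 2) (two A B) (twoArr f g)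

  inject₁ : ∀ {A B T} {f : A ⇒ T} {g : B ⇒ T} → [ f , g ] ∘ inj₁ ≈ f
  inject₁ = ∐.copair∘inj (fin 2) _ zero

  inject₂ : ∀ {A B T} {f : A ⇒ T} {g : B ⇒ T} → [ f , g ] ∘ inj₂ ≈ g
  inject₂ = ∐.copair∘inj (fin 2) _ (suc zero)

  []-unique : ∀ {A B T} {f : A ⇒ T} {g : B ⇒ T} {h : A + B ⇒ T} →
              h ∘ inj₁ ≈ f → h ∘ inj₂ ≈ g → h ≈ [ f , g ]
  []-unique p q = ∐.unique (fin 2) _ λ { zero → p ; (suc zero) → q }

  +-assocˡ : ∀ {A B C} → A + (B + C) ⇒ (A + B) + C
  +-assocˡ = [ inj₁ ∘ inj₁ , [ inj₁ ∘ inj₂ , inj₂ ] ]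

  ⟨⟩-unique : ∀ {A B T} {f : T ⇒ A} {g : T ⇒ B} {h : T ⇒ A × B} →
              π₁ ∘ h ≈ f → π₂ ∘ h ≈ g → h ≈ ⟨ f , g ⟩
  ⟨⟩-unique = ×′.unique _ _

  π₁∘⟨⟩ : ∀ {A B T} {f : T ⇒ A} {g : T ⇒ B} → π₁ ∘ ⟨ f , g ⟩ ≈ f
  π₁∘⟨⟩ = ×′.π₁∘⟨⟩ _ _

  π₂∘⟨⟩ : ∀ {A B T} {f : T ⇒ A} {g : T ⇒ B} → π₂ ∘ ⟨ f , g ⟩ ≈ g
  π₂∘⟨⟩ = ×′.π₂∘⟨⟩ _ _

  ⟨⟩-cong : ∀ {A B T} {f f′ : T ⇒ A} {g g′ : T ⇒ B} →
            f ≈ f′ → g ≈ g′ → ⟨ f , g ⟩ ≈ ⟨ f′ , g′ ⟩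
  ⟨⟩-cong p q = ⟨⟩-unique (≈-trans π₁∘⟨⟩ p) (≈-trans π₂∘⟨⟩ q)

  ⟨⟩∘ : ∀ {A B S T} {f : T ⇒ A} {g : T ⇒ B} {h : S ⇒ T} →
        ⟨ f , g ⟩ ∘ h ≈ ⟨ f ∘ h , g ∘ h ⟩
  ⟨⟩∘ = ⟨⟩-unique (pullˡ π₁∘⟨⟩) (pullˡ π₂∘⟨⟩)

  !-unique₂ : ∀ {A} {f g : A ⇒ ⊤} → f ≈ g
  !-unique₂ = ≈-trans (!-unique _) (≈-sym (!-unique _))

  universal-cong : ∀ {A B C T} {f : A ⇒ C} {g : B ⇒ C} (pb : Pullback 𝔈 f g)
    {h k : T ⇒ Pullback.P pb} →
    Pullback.p₁ pb ∘ h ≈ Pullback.p₁ pb ∘ k →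
    Pullback.p₂ pb ∘ h ≈ Pullback.p₂ pb ∘ k → h ≈ k
  universal-cong pb p q = ≈-trans
    (Pullback.unique pb {eq = eq} p q)
    (≈-sym (Pullback.unique pb ≈-refl ≈-refl))
    where eq = ≈-trans (pullˡ (Pullback.commute pb)) assoc

  copair-unique₂ : ∀ κ {A : El κ → Obj} {T} {h k : ∐.obj κ A ⇒ T} →
    (∀ i → h ∘ ∐.inj κ A i ≈ k ∘ ∐.inj κ A i) → h ≈ k
  copair-unique₂ κ {A} p = ≈-trans
    (∐.unique κ A p) (≈-sym (∐.unique κ A λ i → ≈-refl))

  -- Any arrow into a countable sum is the sum of its pullbacks along the
  -- injections.
  module PullbackSum κ (A : El κ → Obj) {C : Obj} (g : C ⇒ ∐.obj κ A)
                     (pb : ∀ i → Pullback 𝔈 g (∐.inj κ A i)) where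
    private
      module pb i = Pullback (pb i)
      module ∐A = ∐ κ A
      E = extensive κ A
      F = sumFunctor sums κ A
      module F = Functor F
      module E = IsCategoryEquivalence E
      module SE = Category (Slice 𝔈 ∐A.obj)
      module ε = NaturalIsomorphism E.counit
      B = Functor.F₀ E.inverse (sliceobj g)
      module B i = SliceObj (B i)
      module ∐B = ∐ κ (λ i → B.dom i)
      PF : ∀ i → SliceObj 𝔈 (A i)
      PF i = sliceobj (pb.p₂ i)
      module ∐P = ∐ κ (λ i → pb.P i)

    collect : ∐P.obj ⇒ C
    collect = ∐P.copair pb.p₁

    private
      φ : ∐B.obj ⇒ C
      φ = SliceArr.hom (ε.η (sliceobj g))
      φ⁻¹ : C ⇒ ∐B.obj
      φ⁻¹ = SliceArr.hom (SE.IsIso.inv (ε.iso (sliceobj g)))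
      φ⁻¹-tri = SliceArr.triangle (SE.IsIso.inv (ε.iso (sliceobj g)))
      φ⁻¹φ : φ⁻¹ ∘ φ ≈ id
      φ⁻¹φ = SE.IsIso.isoˡ (ε.iso (sliceobj g))
      φφ⁻¹ : φ ∘ φ⁻¹ ≈ id
      φφ⁻¹ = SE.IsIso.isoʳ (ε.iso (sliceobj g))

      square : ∀ i → g ∘ (φ ∘ ∐B.inj i) ≈ ∐A.inj i ∘ B.arr i
      square i = ≈-trans (pullˡ (SliceArr.triangle (ε.η (sliceobj g))))
                         (∐B.copair∘inj i)

      u : ∀ i → B.dom i ⇒ pb.P i
      u i = pb.universal i (square i)

      ∑u : ∐B.obj ⇒ ∐P.obj
      ∑u = ∐B.copair λ i → ∐P.inj i ∘ u i

      collect-tri : g ∘ collect ≈ SliceObj.arr (F.F₀ PF)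
      collect-tri = ∐P.unique λ i →
        ≈-trans (pullʳ (∐P.copair∘inj i)) (pb.commute i)

      back : F.F₀ PF SE.⇒ F.F₀ B
      back = slicearr (≈-trans (pullˡ φ⁻¹-tri) collect-tri)

      w : ∀ i → SliceArr 𝔈 (PF i) (B i)
      w = functorPreimage E {A = PF} {B = B} back

      w-hom : ∀ i → pb.P i ⇒ B.dom i
      w-hom i = SliceArr.hom (w i)

      back∘inj : ∀ i → (φ⁻¹ ∘ collect) ∘ ∐P.inj i ≈ ∐B.inj i ∘ w-hom i
      back∘inj i = ≈-trans (≈-sym (functor-full E {A = PF} {B = B} back) ⟩∘ _) (∐P.copair∘inj i)

      φw : ∀ i → φ ∘ (∐B.inj i ∘ w-hom i) ≈ pb.p₁ i
      φw i = begin
        φ ∘ (∐B.inj i ∘ w-hom i)           ≈⟨ φ ∘⟨ back∘inj i ⟨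
        φ ∘ ((φ⁻¹ ∘ collect) ∘ ∐P.inj i)   ≈⟨ pullˡ (pullˡ φφ⁻¹) ⟩
        (id ∘ collect) ∘ ∐P.inj i          ≈⟨ identityˡ ⟩∘ _ ⟩
        collect ∘ ∐P.inj i                 ≈⟨ ∐P.copair∘inj i ⟩
        pb.p₁ i                            ∎
        where open HomReasoning

      uw : ∀ i → u i ∘ w-hom i ≈ id
      uw i = universal-cong (pb i)
        (begin
          pb.p₁ i ∘ (u i ∘ w-hom i)   ≈⟨ pullˡ (pb.p₁∘universal i) ⟩
          (φ ∘ ∐B.inj i) ∘ w-hom i    ≈⟨ assoc ⟩
          φ ∘ (∐B.inj i ∘ w-hom i)    ≈⟨ φw i ⟩
          pb.p₁ i                     ≈⟨ identityʳ ⟨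
          pb.p₁ i ∘ id                ∎)
        (begin
          pb.p₂ i ∘ (u i ∘ w-hom i)   ≈⟨ pullˡ (pb.p₂∘universal i) ⟩
          B.arr i ∘ w-hom i           ≈⟨ SliceArr.triangle (w i) ⟩
          pb.p₂ i                     ≈⟨ identityʳ ⟨
          pb.p₂ i ∘ id                ∎)
        where open HomReasoning

      collect∑u : collect ∘ ∑u ≈ φ
      collect∑u = copair-unique₂ κ λ i → begin
        (collect ∘ ∑u) ∘ ∐B.inj i         ≈⟨ pullʳ (∐B.copair∘inj i) ⟩
        collect ∘ (∐P.inj i ∘ u i)        ≈⟨ pullˡ (∐P.copair∘inj i) ⟩
        pb.p₁ i ∘ u i                     ≈⟨ pb.p₁∘universal i ⟩
        φ ∘ ∐B.inj i                      ∎
        where open HomReasoning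

    isIso : IsIso collect
    isIso = record
      { inv  = ∑u ∘ φ⁻¹
      ; isoˡ = copair-unique₂ κ λ i → begin
          ((∑u ∘ φ⁻¹) ∘ collect) ∘ ∐P.inj i   ≈⟨ assoc ⟩∘ _ ⟩
          (∑u ∘ (φ⁻¹ ∘ collect)) ∘ ∐P.inj i   ≈⟨ pullʳ (back∘inj i) ⟩
          ∑u ∘ (∐B.inj i ∘ w-hom i)           ≈⟨ pullˡ (∐B.copair∘inj i) ⟩
          (∐P.inj i ∘ u i) ∘ w-hom i          ≈⟨ pullʳ (uw i) ⟩
          ∐P.inj i ∘ id                       ≈⟨ identityʳ ⟩
          ∐P.inj i                            ≈⟨ identityˡ ⟨
          id ∘ ∐P.inj i                       ∎
      ; isoʳ = ≈-trans (pullˡ collect∑u) φφ⁻¹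
      }
      where open HomReasoning

  ×-ext : ∀ {A B T} {h k : T ⇒ A × B} → π₁ ∘ h ≈ π₁ ∘ k → π₂ ∘ h ≈ π₂ ∘ k → h ≈ k
  ×-ext p q = ≈-trans (⟨⟩-unique p q) (≈-sym (⟨⟩-unique ≈-refl ≈-refl))

  ⟨π₁∘,π₂∘⟩ : ∀ {A B T} {h : T ⇒ A × B} → ⟨ π₁ ∘ h , π₂ ∘ h ⟩ ≈ h
  ⟨π₁∘,π₂∘⟩ = ≈-sym (⟨⟩-unique ≈-refl ≈-refl)

  N : Obj
  N = ∐.obj ω (λ _ → ⊤)

  num : ℕ → ⊤ ⇒ N
  num = ∐.inj ω (λ _ → ⊤)

  Copies : Obj → Obj
  Copies Z = ∐.obj ω (λ _ → Z)

  row : ∀ {Z} → ℕ → Z ⇒ N × Z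
  row n = ⟨ num n ∘ ! , id ⟩

  rows : ∀ {Z} → Copies Z ⇒ N × Z
  rows {Z} = ∐.copair ω (λ _ → Z) row

  rowPullback : ∀ {Z} n → Pullback 𝔈 (π₁ {N} {Z}) (num n)
  rowPullback {Z} n = record
    { P  = Z
    ; p₁ = row n
    ; p₂ = !
    ; commute = π₁∘⟨⟩
    ; universal = λ {_} {h₁} _ → π₂ ∘ h₁
    ; p₁∘universal = λ {_} {h₁} {h₂} {eq} → ×-ext
        (begin
          π₁ ∘ (row n ∘ (π₂ ∘ h₁))   ≈⟨ pullˡ π₁∘⟨⟩ ⟩
          (num n ∘ !) ∘ (π₂ ∘ h₁)    ≈⟨ pullʳ !-unique₂ ⟩
          num n ∘ h₂                 ≈⟨ eq ⟨
          π₁ ∘ h₁                    ∎)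
        (≈-trans (pullˡ π₂∘⟨⟩) identityˡ)
    ; p₂∘universal = !-unique₂
    ; unique = λ {_} {h₁} {_} {_} {h} p _ → begin
        h                  ≈⟨ identityˡ ⟨
        id ∘ h             ≈⟨ pullˡ π₂∘⟨⟩ ⟨
        π₂ ∘ (row n ∘ h)   ≈⟨ π₂ ∘⟨ p ⟩
        π₂ ∘ h₁            ∎
    }
    where open HomReasoning

  rows-isIso : ∀ {Z} → IsIso (rows {Z})
  rows-isIso {Z} = PullbackSum.isIso ω (λ _ → ⊤) π₁ rowPullback

  -- N × Z ≅ Z + Z + ⋯ ⟶ T, with components a 0, a 1, a 2, …
  fromRows : ∀ {Z T} → (ℕ → Z ⇒ T) → N × Z ⇒ T
  fromRows {Z} a = ∐.copair ω (λ _ → Z) a ∘ IsIso.inv rows-isIso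

  fromRows∘row : ∀ {Z T} (a : ℕ → Z ⇒ T) n → fromRows a ∘ row n ≈ a n
  fromRows∘row {Z} a n = begin
    (∐.copair ω (λ _ → Z) a ∘ rows⁻¹) ∘ row n            ≈⟨ _ ∘⟨ ∐.copair∘inj ω _ n ⟨
    (∐.copair ω (λ _ → Z) a ∘ rows⁻¹) ∘ (rows ∘ ∐.inj ω (λ _ → Z) n)
      ≈⟨ pullˡ (pullʳ (IsIso.isoˡ rows-isIso)) ⟩
    (∐.copair ω (λ _ → Z) a ∘ id) ∘ ∐.inj ω (λ _ → Z) n  ≈⟨ identityʳ ⟩∘ _ ⟩
    ∐.copair ω (λ _ → Z) a ∘ ∐.inj ω (λ _ → Z) n         ≈⟨ ∐.copair∘inj ω _ n ⟩
    a n                                                  ∎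
    where
      open HomReasoning
      rows⁻¹ = IsIso.inv (rows-isIso {Z})

  row-ext : ∀ {Z T} {h k : N × Z ⇒ T} → (∀ n → h ∘ row n ≈ k ∘ row n) → h ≈ k
  row-ext {Z} {h = h} {k} p = begin
    h                     ≈⟨ expand h ⟩
    (h ∘ rows) ∘ rows⁻¹   ≈⟨ copair-unique₂ ω (λ n →
      ≈-trans (pullʳ (∐.copair∘inj ω _ n))
      (≈-trans (p n) (≈-sym (pullʳ (∐.copair∘inj ω _ n))))) ⟩∘ _ ⟩
    (k ∘ rows) ∘ rows⁻¹   ≈⟨ expand k ⟨
    k                     ∎
    where
      open HomReasoning
      rows⁻¹ = IsIso.inv (rows-isIso {Z})
      expand : ∀ {T} (h : N × Z ⇒ T) → h ≈ (h ∘ rows) ∘ rows⁻¹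
      expand h = ≈-sym (≈-trans (pullʳ (IsIso.isoʳ rows-isIso)) identityʳ)

  ⟨num,⟩ : ∀ {Z T} n (z : T ⇒ Z) → ⟨ num n ∘ ! , z ⟩ ≈ row n ∘ z
  ⟨num,⟩ n z = ≈-sym (≈-trans ⟨⟩∘ (⟨⟩-cong (pullʳ !-unique₂) identityˡ))

  record MonoidObject : Set (o ⊔ ℓ ⊔ e) where
    field
      M : Obj
      μ : M × M ⇒ M
      ε : ⊤ ⇒ M
      μ-assoc : μ ∘ ⟨ μ ∘ ⟨ π₁ , π₁ ∘ π₂ ⟩ , π₂ ∘ π₂ ⟩ ≈
                μ ∘ ⟨ π₁ , μ ∘ π₂ {M} {M × M} ⟩
      μ-identityˡ : μ ∘ ⟨ ε ∘ ! , id ⟩ ≈ id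
      μ-identityʳ : μ ∘ ⟨ id , ε ∘ ! ⟩ ≈ id

  record Automaton (𝐌 : MonoidObject) : Set (o ⊔ ℓ ⊔ e) where
    open MonoidObject 𝐌
    field
      Z : Obj
      α : M × Z ⇒ Z
      α-assoc : α ∘ ⟨ μ ∘ ⟨ π₁ , π₁ ∘ π₂ ⟩ , π₂ ∘ π₂ ⟩ ≈
                α ∘ ⟨ π₁ , α ∘ π₂ {M} {M × Z} ⟩
      α-identity : α ∘ ⟨ ε ∘ ! , id ⟩ ≈ id

  actOnElements : ∀ {M Z T} (μ : M × M ⇒ M) (α : M × Z ⇒ Z) →
    α ∘ ⟨ μ ∘ ⟨ π₁ , π₁ ∘ π₂ ⟩ , π₂ ∘ π₂ ⟩ ≈ α ∘ ⟨ π₁ , α ∘ π₂ ⟩ →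
    (m n : T ⇒ M) (z : T ⇒ Z) →
    α ∘ ⟨ μ ∘ ⟨ m , n ⟩ , z ⟩ ≈ α ∘ ⟨ m , α ∘ ⟨ n , z ⟩ ⟩
  actOnElements μ α law m n z = begin
    α ∘ ⟨ μ ∘ ⟨ m , n ⟩ , z ⟩
      ≈⟨ α ∘⟨ ≈-trans ⟨⟩∘ (⟨⟩-cong
           (pullʳ (≈-trans ⟨⟩∘ (⟨⟩-cong π₁∘⟨⟩ (≈-trans (pullʳ π₂∘⟨⟩) π₁∘⟨⟩))))
           (≈-trans (pullʳ π₂∘⟨⟩) π₂∘⟨⟩)) ⟨
    α ∘ (⟨ μ ∘ ⟨ π₁ , π₁ ∘ π₂ ⟩ , π₂ ∘ π₂ ⟩ ∘ ⟨ m , ⟨ n , z ⟩ ⟩)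
      ≈⟨ pullˡ law ⟩
    (α ∘ ⟨ π₁ , α ∘ π₂ ⟩) ∘ ⟨ m , ⟨ n , z ⟩ ⟩
      ≈⟨ pullʳ (≈-trans ⟨⟩∘ (⟨⟩-cong π₁∘⟨⟩ (pullʳ π₂∘⟨⟩))) ⟩
    α ∘ ⟨ m , α ∘ ⟨ n , z ⟩ ⟩
      ∎
    where open HomReasoning

  shift : ℕ → N ⇒ N
  shift m = ∐.copair ω (λ _ → ⊤) λ n → num (m +ℕ n)

  μN : N × N ⇒ N
  μN = fromRows shift

  num-cong : ∀ {m n} → m ≡ n → num m ≈ num n
  num-cong ≡.refl = ≈-refl

  μN∘⟨num,num⟩ : ∀ {T} m n →
    μN ∘ ⟨ num m ∘ ! , num n ∘ ! ⟩ ≈ num (m +ℕ n) ∘ ! {T}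
  μN∘⟨num,num⟩ m n = begin
    μN ∘ ⟨ num m ∘ ! , num n ∘ ! ⟩   ≈⟨ μN ∘⟨ ⟨num,⟩ m _ ⟩
    μN ∘ (row m ∘ (num n ∘ !))       ≈⟨ pullˡ (fromRows∘row shift m) ⟩
    shift m ∘ (num n ∘ !)            ≈⟨ pullˡ (∐.copair∘inj ω _ n) ⟩
    num (m +ℕ n) ∘ !                 ∎
    where open HomReasoning

  fromRows-assoc : ∀ {Z} (a : ℕ → Z ⇒ Z) →
    (∀ m n → a (m +ℕ n) ≈ a m ∘ a n) →
    fromRows a ∘ ⟨ μN ∘ ⟨ π₁ , π₁ ∘ π₂ ⟩ , π₂ ∘ π₂ ⟩ ≈
    fromRows a ∘ ⟨ π₁ , fromRows a ∘ π₂ ⟩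
  fromRows-assoc a a-+ = row-ext λ m → row-ext λ n → begin
    ((α ∘ ⟨ μN ∘ ⟨ π₁ , π₁ ∘ π₂ ⟩ , π₂ ∘ π₂ ⟩) ∘ row m) ∘ row n
      ≈⟨ pullʳ (row∘row m n) ⟩
    (α ∘ ⟨ μN ∘ ⟨ π₁ , π₁ ∘ π₂ ⟩ , π₂ ∘ π₂ ⟩) ∘ ⟨ num m ∘ ! , ⟨ num n ∘ ! , id ⟩ ⟩
      ≈⟨ pullʳ (≈-trans ⟨⟩∘ (⟨⟩-cong
           (pullʳ (≈-trans ⟨⟩∘ (⟨⟩-cong π₁∘⟨⟩ (≈-trans (pullʳ π₂∘⟨⟩) π₁∘⟨⟩))))
           (≈-trans (pullʳ π₂∘⟨⟩) π₂∘⟨⟩))) ⟩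
    α ∘ ⟨ μN ∘ ⟨ num m ∘ ! , num n ∘ ! ⟩ , id ⟩
      ≈⟨ α ∘⟨ ⟨⟩-cong (μN∘⟨num,num⟩ m n) ≈-refl ⟩
    α ∘ row (m +ℕ n)
      ≈⟨ fromRows∘row a (m +ℕ n) ⟩
    a (m +ℕ n)
      ≈⟨ a-+ m n ⟩
    a m ∘ a n
      ≈⟨ pullˡ (fromRows∘row a m) ⟨
    α ∘ (row m ∘ a n)
      ≈⟨ α ∘⟨ ⟨num,⟩ m (a n) ⟨
    α ∘ ⟨ num m ∘ ! , a n ⟩
      ≈⟨ α ∘⟨ ⟨⟩-cong ≈-refl (fromRows∘row a n) ⟨
    α ∘ ⟨ num m ∘ ! , α ∘ row n ⟩
      ≈⟨ pullʳ (≈-trans ⟨⟩∘ (⟨⟩-cong π₁∘⟨⟩ (pullʳ π₂∘⟨⟩))) ⟨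
    (α ∘ ⟨ π₁ , α ∘ π₂ ⟩) ∘ ⟨ num m ∘ ! , ⟨ num n ∘ ! , id ⟩ ⟩
      ≈⟨ pullʳ (row∘row m n) ⟨
    ((α ∘ ⟨ π₁ , α ∘ π₂ ⟩) ∘ row m) ∘ row n
      ∎
    where
      open HomReasoning
      α = fromRows a
      row∘row : ∀ {Z} m n → row m ∘ row {Z} n ≈ ⟨ num m ∘ ! , ⟨ num n ∘ ! , id ⟩ ⟩
      row∘row m n = ≈-sym (⟨num,⟩ m _)

  𝐍 : MonoidObject
  𝐍 = record
    { M = N
    ; μ = μN
    ; ε = num 0
    ; μ-assoc = fromRows-assoc shift λ m n → copair-unique₂ ω λ k → begin
        shift (m +ℕ n) ∘ num k       ≈⟨ ∐.copair∘inj ω _ k ⟩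
        num ((m +ℕ n) +ℕ k)          ≈⟨ num-cong (ℕₚ.+-assoc m n k) ⟩
        num (m +ℕ (n +ℕ k))          ≈⟨ ∐.copair∘inj ω _ (n +ℕ k) ⟨
        shift m ∘ num (n +ℕ k)       ≈⟨ shift m ∘⟨ ∐.copair∘inj ω _ k ⟨
        shift m ∘ (shift n ∘ num k)  ≈⟨ assoc ⟨
        (shift m ∘ shift n) ∘ num k  ∎
    ; μ-identityˡ = ≈-trans (fromRows∘row shift 0)
        (copair-unique₂ ω λ k → ≈-trans (∐.copair∘inj ω _ k) (≈-sym identityˡ))
    ; μ-identityʳ = copair-unique₂ ω λ k → begin
        (μN ∘ ⟨ id , num 0 ∘ ! ⟩) ∘ num k
          ≈⟨ pullʳ (≈-trans ⟨⟩∘ (⟨⟩-cong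
               (≈-trans identityˡ (≈-sym (≈-trans (_ ∘⟨ !-unique₂) identityʳ)))
               (pullʳ !-unique₂))) ⟩
        μN ∘ ⟨ num k ∘ ! , num 0 ∘ ! ⟩
          ≈⟨ μN∘⟨num,num⟩ k 0 ⟩
        num (k +ℕ 0) ∘ !
          ≈⟨ ≈-trans (_ ∘⟨ !-unique₂) identityʳ ⟩
        num (k +ℕ 0)
          ≈⟨ num-cong (ℕₚ.+-identityʳ k) ⟩
        num k
          ≈⟨ identityˡ ⟨
        id ∘ num k
          ∎
    }
    where open HomReasoning

  infixr 8 _^_

  _^_ : ∀ {Z} → Z ⇒ Z → ℕ → Z ⇒ Z
  g ^ zero  = id
  g ^ suc n = g ∘ (g ^ n)

  ^-+ : ∀ {Z} (g : Z ⇒ Z) m n → g ^ (m +ℕ n) ≈ (g ^ m) ∘ (g ^ n)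
  ^-+ g zero    n = ≈-sym identityˡ
  ^-+ g (suc m) n = ≈-trans (g ∘⟨ ^-+ g m n) (≈-sym assoc)

  loopAutomaton : ∀ {Z} → Z ⇒ Z → Automaton 𝐍
  loopAutomaton {Z} g = record
    { Z = Z
    ; α = fromRows (g ^_)
    ; α-assoc = fromRows-assoc (g ^_) (^-+ g)
    ; α-identity = fromRows∘row (g ^_) 0
    }

  record InternalCategory : Set (o ⊔ ℓ ⊔ e) where
    field
      C₀ C₁ : Obj
      ∂₀ ∂₁ : C₁ ⇒ C₀
      ide   : C₀ ⇒ C₁

    -- Composable pairs (b , a), with a applied first.
    module C₂ = Pb ∂₀ ∂₁

    field
      comp : C₂.P ⇒ C₁

    -- Composition of generalized elements.  The laws below are stated on
    -- these; at the generic elements they are the usual diagrams.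
    compose : ∀ {T} (b a : T ⇒ C₁) → ∂₀ ∘ b ≈ ∂₁ ∘ a → T ⇒ C₁
    compose b a p = comp ∘ C₂.universal p

    field
      ∂₀-ide  : ∂₀ ∘ ide ≈ id
      ∂₁-ide  : ∂₁ ∘ ide ≈ id
      ∂₀-comp : ∂₀ ∘ comp ≈ ∂₀ ∘ C₂.p₂
      ∂₁-comp : ∂₁ ∘ comp ≈ ∂₁ ∘ C₂.p₁
      comp-identityˡ : ∀ {T} (a : T ⇒ C₁) (p : ∂₀ ∘ (ide ∘ (∂₁ ∘ a)) ≈ ∂₁ ∘ a) →
                       compose (ide ∘ (∂₁ ∘ a)) a p ≈ a
      comp-identityʳ : ∀ {T} (a : T ⇒ C₁) (p : ∂₀ ∘ a ≈ ∂₁ ∘ (ide ∘ (∂₀ ∘ a))) →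
                       compose a (ide ∘ (∂₀ ∘ a)) p ≈ a
      comp-assoc : ∀ {T} (c b a : T ⇒ C₁)
                   (p : ∂₀ ∘ c ≈ ∂₁ ∘ b) (q : ∂₀ ∘ b ≈ ∂₁ ∘ a)
                   (r : ∂₀ ∘ compose c b p ≈ ∂₁ ∘ a)
                   (s : ∂₀ ∘ c ≈ ∂₁ ∘ compose b a q) →
                   compose (compose c b p) a r ≈ compose c (compose b a q) s

  record InternalFunctor (C D : InternalCategory) : Set (o ⊔ ℓ ⊔ e) where
    private
      module C = InternalCategory C
      module D = InternalCategory D
    field
      F₀ : C.C₀ ⇒ D.C₀
      F₁ : C.C₁ ⇒ D.C₁
      F-∂₀ : D.∂₀ ∘ F₁ ≈ F₀ ∘ C.∂₀
      F-∂₁ : D.∂₁ ∘ F₁ ≈ F₀ ∘ C.∂₁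

    F₂ : C.C₂.P ⇒ D.C₂.P
    F₂ = D.C₂.universal {h₁ = F₁ ∘ C.C₂.p₁} {h₂ = F₁ ∘ C.C₂.p₂}
      (≈-trans (pullˡ F-∂₀) (≈-trans (pullʳ C.C₂.commute)
      (≈-sym (≈-trans (pullˡ F-∂₁) assoc))))

    field
      F-ide  : F₁ ∘ C.ide ≈ D.ide ∘ F₀
      F-comp : F₁ ∘ C.comp ≈ D.comp ∘ F₂

    module ∂₀⁻¹F₀ = Pb D.∂₀ F₀
    module ∂₁⁻¹F₀ = Pb D.∂₁ F₀
    module ∩      = Pb ∂₀⁻¹F₀.p₁ ∂₁⁻¹F₀.p₁

    factorization : C.C₁ ⇒ ∩.P
    factorization = ∩.universal
      {h₁ = ∂₀⁻¹F₀.universal F-∂₀} {h₂ = ∂₁⁻¹F₀.universal F-∂₁}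
      (≈-trans ∂₀⁻¹F₀.p₁∘universal (≈-sym ∂₁⁻¹F₀.p₁∘universal))

  Trans : ∀ {𝐌} → Automaton 𝐌 → InternalCategory
  Trans {𝐌} 𝐙 = record
    { C₀ = Z
    ; C₁ = M × Z
    ; ∂₀ = π₂
    ; ∂₁ = α
    ; ide = ⟨ ε ∘ ! , id ⟩
    ; comp = comp
    ; ∂₀-ide = π₂∘⟨⟩
    ; ∂₁-ide = α-identity
    ; ∂₀-comp = π₂∘⟨⟩
    ; ∂₁-comp = begin
        α ∘ comp
          ≈⟨ actOnElements μ α α-assoc _ _ _ ⟩
        α ∘ ⟨ π₁ ∘ C₂.p₁ , α ∘ ⟨ π₁ ∘ C₂.p₂ , π₂ ∘ C₂.p₂ ⟩ ⟩
          ≈⟨ α ∘⟨ ⟨⟩-cong ≈-refl (≈-trans (α ∘⟨ ⟨π₁∘,π₂∘⟩) (≈-sym C₂.commute)) ⟩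
        α ∘ ⟨ π₁ ∘ C₂.p₁ , π₂ ∘ C₂.p₁ ⟩
          ≈⟨ α ∘⟨ ⟨π₁∘,π₂∘⟩ ⟩
        α ∘ C₂.p₁
          ∎
    ; comp-identityˡ = λ a p → begin
        comp ∘ C₂.universal p
          ≈⟨ comp∘universal p ⟩
        ⟨ μ ∘ ⟨ π₁ ∘ (⟨ ε ∘ ! , id ⟩ ∘ (α ∘ a)) , π₁ ∘ a ⟩ , π₂ ∘ a ⟩
          ≈⟨ ⟨⟩-cong (≈-trans (μ ∘⟨ ⟨⟩-cong π₁∘ide ≈-refl) (μ-unitˡ (π₁ ∘ a))) ≈-refl ⟩
        ⟨ π₁ ∘ a , π₂ ∘ a ⟩
          ≈⟨ ⟨π₁∘,π₂∘⟩ ⟩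
        a
          ∎
    ; comp-identityʳ = λ a p → begin
        comp ∘ C₂.universal p
          ≈⟨ comp∘universal p ⟩
        ⟨ μ ∘ ⟨ π₁ ∘ a , π₁ ∘ (⟨ ε ∘ ! , id ⟩ ∘ (π₂ ∘ a)) ⟩
        , π₂ ∘ (⟨ ε ∘ ! , id ⟩ ∘ (π₂ ∘ a)) ⟩
          ≈⟨ ⟨⟩-cong (≈-trans (μ ∘⟨ ⟨⟩-cong ≈-refl π₁∘ide) (μ-unitʳ (π₁ ∘ a)))
                     (≈-trans (pullˡ π₂∘⟨⟩) identityˡ) ⟩
        ⟨ π₁ ∘ a , π₂ ∘ a ⟩
          ≈⟨ ⟨π₁∘,π₂∘⟩ ⟩
        a
          ∎
    ; comp-assoc = λ c b a p q r s → begin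
        comp ∘ C₂.universal r
          ≈⟨ comp∘universal r ⟩
        ⟨ μ ∘ ⟨ π₁ ∘ (comp ∘ C₂.universal p) , π₁ ∘ a ⟩ , π₂ ∘ a ⟩
          ≈⟨ ⟨⟩-cong (μ ∘⟨ ⟨⟩-cong (≈-trans (π₁ ∘⟨ comp∘universal p) π₁∘⟨⟩) ≈-refl)
                     ≈-refl ⟩
        ⟨ μ ∘ ⟨ μ ∘ ⟨ π₁ ∘ c , π₁ ∘ b ⟩ , π₁ ∘ a ⟩ , π₂ ∘ a ⟩
          ≈⟨ ⟨⟩-cong (actOnElements μ μ μ-assoc _ _ _) ≈-refl ⟩
        ⟨ μ ∘ ⟨ π₁ ∘ c , μ ∘ ⟨ π₁ ∘ b , π₁ ∘ a ⟩ ⟩ , π₂ ∘ a ⟩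
          ≈⟨ ⟨⟩-cong (μ ∘⟨ ⟨⟩-cong ≈-refl (≈-trans (π₁ ∘⟨ comp∘universal q) π₁∘⟨⟩))
                     (≈-trans (π₂ ∘⟨ comp∘universal q) π₂∘⟨⟩) ⟨
        ⟨ μ ∘ ⟨ π₁ ∘ c , π₁ ∘ (comp ∘ C₂.universal q) ⟩
        , π₂ ∘ (comp ∘ C₂.universal q) ⟩
          ≈⟨ comp∘universal s ⟨
        comp ∘ C₂.universal s
          ∎
    }
    where
      open MonoidObject 𝐌
      open Automaton 𝐙
      open HomReasoning
      module C₂ = Pb {M × Z} {M × Z} π₂ α

      -- (m′ , m · z) , (m , z)  ↦  (m′ m , z)
      comp : C₂.P ⇒ M × Z
      comp = ⟨ μ ∘ ⟨ π₁ ∘ C₂.p₁ , π₁ ∘ C₂.p₂ ⟩ , π₂ ∘ C₂.p₂ ⟩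

      comp∘universal : ∀ {T} {b a : T ⇒ M × Z} (p : π₂ ∘ b ≈ α ∘ a) →
        comp ∘ C₂.universal p ≈ ⟨ μ ∘ ⟨ π₁ ∘ b , π₁ ∘ a ⟩ , π₂ ∘ a ⟩
      comp∘universal p = ≈-trans ⟨⟩∘ (⟨⟩-cong
        (pullʳ (≈-trans ⟨⟩∘ (⟨⟩-cong (pullʳ C₂.p₁∘universal) (pullʳ C₂.p₂∘universal))))
        (pullʳ C₂.p₂∘universal))

      π₁∘ide : ∀ {T} {z : T ⇒ Z} → π₁ ∘ (⟨ ε ∘ ! , id ⟩ ∘ z) ≈ ε ∘ !
      π₁∘ide = ≈-trans (pullˡ π₁∘⟨⟩) (pullʳ !-unique₂)

      μ-unitˡ : ∀ {T} (m : T ⇒ M) → μ ∘ ⟨ ε ∘ ! , m ⟩ ≈ m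
      μ-unitˡ m = begin
        μ ∘ ⟨ ε ∘ ! , m ⟩           ≈⟨ μ ∘⟨ ≈-trans ⟨⟩∘ (⟨⟩-cong (pullʳ !-unique₂) identityˡ) ⟨
        μ ∘ (⟨ ε ∘ ! , id ⟩ ∘ m)    ≈⟨ pullˡ μ-identityˡ ⟩
        id ∘ m                      ≈⟨ identityˡ ⟩
        m                           ∎

      μ-unitʳ : ∀ {T} (m : T ⇒ M) → μ ∘ ⟨ m , ε ∘ ! ⟩ ≈ m
      μ-unitʳ m = begin
        μ ∘ ⟨ m , ε ∘ ! ⟩           ≈⟨ μ ∘⟨ ≈-trans ⟨⟩∘ (⟨⟩-cong identityˡ (pullʳ !-unique₂)) ⟨
        μ ∘ (⟨ id , ε ∘ ! ⟩ ∘ m)    ≈⟨ pullˡ μ-identityʳ ⟩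
        id ∘ m                      ≈⟨ identityˡ ⟩
        m                           ∎

  record Refinement {𝐌 𝐌′} (𝐙 : Automaton 𝐌) (𝐙′ : Automaton 𝐌′) : Set (o ⊔ ℓ ⊔ e) where
    field
      functor : InternalFunctor (Trans 𝐙) (Trans 𝐙′)
    open InternalFunctor functor public
    field
      injective : Mono F₀
      faithful  : Mono F₁
      full      : Epi factorization

  stateInclusion : ∀ {X U Y} → X + Y ⇒ X + (U + Y)
  stateInclusion = [ inj₁ , inj₂ ∘ inj₂ ]

  module Iteration {X U Y : Obj} (f : X + U ⇒ U + Y) where
    f∣X : X ⇒ U + Y
    f∣X = f ∘ inj₁

    f∣U : U ⇒ U + Y
    f∣U = f ∘ inj₂

    -- f⟨ k ⟩ is fₖ.
    mutual
      Dom : ℕ → Obj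
      Dom zero    = X
      Dom (suc k) = Pb.P f⟨ k ⟩ inj₁

      f⟨_⟩ : ∀ k → Dom k ⇒ U + Y
      f⟨ zero ⟩  = f∣X
      f⟨ suc k ⟩ = f∣U ∘ Pb.p₂ f⟨ k ⟩ inj₁

    -- The composite inclusion Dom k → Dom (k - 1) → ⋯ → X.
    inclusion : ∀ k → Dom k ⇒ X
    inclusion zero    = id
    inclusion (suc k) = inclusion k ∘ Pb.p₁ f⟨ k ⟩ inj₁

    -- fₖ⁻¹(Y)
    Exit : ℕ → Obj
    Exit k = Pb.P f⟨ k ⟩ inj₂

    exits : ∐.obj ω Exit ⇒ X
    exits = ∐.copair ω Exit λ k → inclusion k ∘ Pb.p₁ f⟨ k ⟩ inj₂

    Terminating : Set (ℓ ⊔ e)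
    Terminating = IsIso exits

    call : Terminating → X ⇒ Y
    call t = ∐.copair ω Exit (λ k → Pb.p₂ f⟨ k ⟩ inj₂) ∘ IsIso.inv t

    calledLoop : Terminating → X + Y ⇒ X + Y
    calledLoop t = inj₂ ∘ [ call t , id ]

    -- The loop h on X + U + Y, bracketed as X + (U + Y).
    processorLoop : X + (U + Y) ⇒ X + (U + Y)
    processorLoop = inj₂ ∘ [ f , inj₂ ] ∘ +-assocˡ

{-# OPTIONS --safe #-}
module Submission where

open import Data.Empty using (⊥-elim)
open import Data.Fin using (zero; suc)
import Data.Fin.Properties as Finₚ
open import Data.Nat using (ℕ; zero; suc; _<′_; _∸_; <′-base; ≤′-step; ≤′-reflexive) renaming (_+_ to _+ℕ_)
import Data.Nat.Properties as ℕₚ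
open import Data.Product using (Σ-syntax; ∃-syntax; _,_)
open import Relation.Binary.Definitions using (DecidableEquality)
open import Relation.Binary.PropositionalEquality as ≡ using (_≡_; _≢_)
open import Relation.Nullary using (yes; no)
open import Level using (_⊔_)
open import Defs

-- Everything is checked on generalized elements, which may be split into cases
-- because, by extensivity, an arrow into a sum is the sum of its pullbacks.  An
-- element x of fₖ⁻¹(Y) reaches call[f](x) under h after exactly k + 1 steps,
-- and after 1, …, k steps it lies in U.  So F₁ sends (0 , x) to (0 , x),
-- (n + 1 , x) to (n + 1 + k , x) and (n , y) to (n , y), and the only arrows
-- of Trans(X′) with both ends in X + Y are of these forms.

-- Arithmetic of step counts.

-- F₁ sends (n , x) with x in fₖ⁻¹(Y) to (delay n k , x).  Elements of Y are
-- treated as the case k = 0, since delay n 0 ≡ n.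
delay : ℕ → ℕ → ℕ
delay zero    k = zero
delay (suc n) k = n +ℕ suc k

delay-zero : ∀ n → delay n 0 ≡ n
delay-zero zero    = ≡.refl
delay-zero (suc n) = ℕₚ.+-comm n 1

delay-injective : ∀ m n k → delay m k ≡ delay n k → m ≡ n
delay-injective zero    zero    k p = ≡.refl
delay-injective zero    (suc n) k p with () ← ≡.trans p (ℕₚ.+-suc n k)
delay-injective (suc m) zero    k p with () ← ≡.trans (≡.sym p) (ℕₚ.+-suc m k)
delay-injective (suc m) (suc n) k p = ≡.cong suc (ℕₚ.+-cancelʳ-≡ (suc k) m n p)

-- After one step of the called loop the state lies in Y, so `m` further steps of it cost exactly
-- `m` steps of the processor loop.
delay-+-suc : ∀ m n k → delay (m +ℕ suc n) k ≡ m +ℕ delay (suc n) k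
delay-+-suc m n k rewrite ℕₚ.+-suc m n = ℕₚ.+-assoc m n (suc k)

-- The numbers missed by `delay _ k` are 1, ..., `k`: the step counts at which the processor is
-- still in U. Induction on `_<′_` later follows the tower of pullbacks `Dom`.
data DelayView (k : ℕ) : ℕ → Set where
  delayed : ∀ n → DelayView k (delay n k)
  early   : ∀ {j} → j <′ k → DelayView k (suc j)

delayView : ∀ k n → DelayView k n
delayView k zero = delayed zero
delayView k (suc j) with j ℕₚ.<? k
... | yes j<k = early (ℕₚ.<⇒<′ j<k)
-- `suc j` steps of the processor split into `suc k` for the first step of the called loop and
-- `j ∸ k` for the remaining ones.
... | no  j≮k = ≡.subst (DelayView k) eq (delayed (suc (j ∸ k)))
  where
    eq : (j ∸ k) +ℕ suc k ≡ suc j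
    eq = ≡.trans (ℕₚ.+-suc _ k) (≡.cong suc (ℕₚ.m∸n+n≡m (ℕₚ.≮⇒≥ j≮k)))

-- Countable sums: case analysis, disjointness and monic injections.

_≟El_ : ∀ {κ} → DecidableEquality (El κ)
_≟El_ {fin n} = Finₚ._≟_
_≟El_ {ω}     = ℕₚ._≟_

module _ {o ℓ e} {𝔈 : Category o ℓ e} (L : CountablyLextensive 𝔈) where
  open Category 𝔈
  open CountablyLextensive L using (limits)
  open FiniteLimits limits using (pullback)
  open Lextensive L renaming (inj₁ to i₁; inj₂ to i₂)
  open HomReasoning

  private
    infixr 5 _⟨≈⟩_
    _⟨≈⟩_ : ∀ {A B} {f g h : A ⇒ B} → f ≈ g → g ≈ h → f ≈ h
    _⟨≈⟩_ = ≈-trans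

  iso-epi : ∀ {A B} {f : A ⇒ B} → IsIso f → Epi f
  iso-epi {f = f} iso r s p = begin
    r              ≈⟨ identityʳ ⟨
    r ∘ id         ≈⟨ r ∘⟨ isoʳ ⟨
    r ∘ (f ∘ inv)  ≈⟨ pullˡ p ⟩
    (s ∘ f) ∘ inv  ≈⟨ pullʳ isoʳ ⟩
    s ∘ id         ≈⟨ identityʳ ⟩
    s              ∎
    where open IsIso iso

  iso-mono : ∀ {A B} {f : A ⇒ B} → IsIso f → Mono f
  iso-mono {f = f} iso r s p = begin
    r              ≈⟨ identityˡ ⟨
    id ∘ r         ≈⟨ isoˡ ⟩∘ r ⟨
    (inv ∘ f) ∘ r  ≈⟨ pullʳ p ⟩
    inv ∘ (f ∘ s)  ≈⟨ pullˡ isoˡ ⟩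
    id ∘ s         ≈⟨ identityˡ ⟩
    s              ∎
    where open IsIso iso

  module Split κ (A : El κ → Obj) {C : Obj} (g : C ⇒ ∐.obj κ A) where
    module pb i = Pullback (pullback g (∐.inj κ A i))
    module S = PullbackSum κ A g (λ i → pullback g (∐.inj κ A i))
    module ∐P = ∐ κ (λ i → pb.P i)

    section : ∀ {i} (a : C ⇒ A i) → g ≈ ∐.inj κ A i ∘ a → C ⇒ pb.P i
    section {i} a p = pb.universal i (≈-trans identityʳ p)

    -- Both sides are right inverses of `S.collect`, which is mono. Disjointness and monicity of the
    -- injections follow by evaluating suitable maps out of the sum on both sides.
    sections-agree : ∀ {i j} {a : C ⇒ A i} {b : C ⇒ A j}
      (p : g ≈ ∐.inj κ A i ∘ a) (q : g ≈ ∐.inj κ A j ∘ b) →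
      ∐P.inj i ∘ section a p ≈ ∐P.inj j ∘ section b q
    sections-agree p q = iso-mono S.isIso _ _ (≈-trans (lemma p) (≈-sym (lemma q)))
      where
        lemma : ∀ {i} {a : C ⇒ A i} (p : g ≈ ∐.inj κ A i ∘ a) →
                S.collect ∘ (∐P.inj i ∘ section a p) ≈ id
        lemma {i} p = ≈-trans (pullˡ (∐P.copair∘inj i)) (pb.p₁∘universal i)

  -- The pullbacks of `t` along the injections jointly cover `T`, because `S.collect` is an
  -- isomorphism and hence epi.
  case-ext : ∀ κ {A : El κ → Obj} {T S} (t : T ⇒ ∐.obj κ A) {r s : T ⇒ S} →
    (∀ i {V} (v : V ⇒ T) (w : V ⇒ A i) → t ∘ v ≈ ∐.inj κ A i ∘ w → r ∘ v ≈ s ∘ v) →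
    r ≈ s
  case-ext κ {A} t p = iso-epi S.isIso _ _ (copair-unique₂ κ λ i → begin
    (_ ∘ S.collect) ∘ ∐P.inj i   ≈⟨ pullʳ (∐P.copair∘inj i) ⟩
    _ ∘ pb.p₁ i                  ≈⟨ p i (pb.p₁ i) (pb.p₂ i) (pb.commute i) ⟩
    _ ∘ pb.p₁ i                  ≈⟨ pullʳ (∐P.copair∘inj i) ⟨
    (_ ∘ S.collect) ∘ ∐P.inj i   ∎)
    where open Split κ A t

  -- A map that is r on the i-th summand of V and s on the j-th takes both values,
  -- because the two sections of the isomorphism collect agree.
  inj-disjoint : ∀ κ {A : El κ → Obj} {i j} → i ≢ j → ∀ {V} {a : V ⇒ A i} {b : V ⇒ A j} →
    ∐.inj κ A i ∘ a ≈ ∐.inj κ A j ∘ b → ∀ {S} (r s : V ⇒ S) → r ≈ s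
  inj-disjoint κ {A} {i} {j} i≢j {V} {a} {b} p {S} r s = begin
    r                                    ≈⟨ here ⟨
    m ∘ (∐P.inj i ∘ section a ≈-refl)    ≈⟨ m ∘⟨ sections-agree ≈-refl p ⟩
    m ∘ (∐P.inj j ∘ section b p)         ≈⟨ there ⟩
    s                                    ∎
    where
      open Split κ A (∐.inj κ A i ∘ a)
      pick : El κ → V ⇒ S
      pick k with i ≟El k
      ... | yes _ = r
      ... | no  _ = s
      pick-i : pick i ≈ r
      pick-i with i ≟El i
      ... | yes _  = ≈-refl
      ... | no i≢i = ⊥-elim (i≢i ≡.refl)
      pick-j : pick j ≈ s
      pick-j with i ≟El j
      ... | yes i≡j = ⊥-elim (i≢j i≡j)
      ... | no  _   = ≈-refl
      m : ∐P.obj ⇒ S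
      m = ∐P.copair λ k → pick k ∘ pb.p₁ k
      m∘inj : ∀ k {c : V ⇒ A k} (q : ∐.inj κ A i ∘ a ≈ ∐.inj κ A k ∘ c) →
              m ∘ (∐P.inj k ∘ section c q) ≈ pick k
      m∘inj k q = ≈-trans (pullˡ (∐P.copair∘inj k))
                          (≈-trans (pullʳ (pb.p₁∘universal k)) identityʳ)
      here  = ≈-trans (m∘inj i ≈-refl) pick-i
      there = ≈-trans (m∘inj j p) pick-j

  -- The projection `pb.p₂ i` recovers `a` from its section and `b` from its own. Extended to the
  -- whole sum, it identifies them because the sections agree.
  inj-mono : ∀ κ {A : El κ → Obj} i → Mono (∐.inj κ A i)
  inj-mono κ {A} i {V} a b p = begin
    a                                    ≈⟨ m∘inj ≈-refl ⟨
    m ∘ (∐P.inj i ∘ section a ≈-refl)    ≈⟨ m ∘⟨ sections-agree ≈-refl p ⟩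
    m ∘ (∐P.inj i ∘ section b p)         ≈⟨ m∘inj p ⟩
    b                                    ∎
    where
      open Split κ A (∐.inj κ A i ∘ a)
      -- Off the i-th summand the value is irrelevant.
      value : ∀ k → pb.P k ⇒ A i
      value k with i ≟El k
      ... | yes ≡.refl = pb.p₂ k
      ... | no  _      = a ∘ pb.p₁ k
      value-i : value i ≈ pb.p₂ i
      value-i with i ≟El i
      ... | yes ≡.refl = ≈-refl
      ... | no i≢i     = ⊥-elim (i≢i ≡.refl)
      m : ∐P.obj ⇒ A i
      m = ∐P.copair value
      m∘inj : ∀ {c : V ⇒ A i} (q : ∐.inj κ A i ∘ a ≈ ∐.inj κ A i ∘ c) →
              m ∘ (∐P.inj i ∘ section c q) ≈ c
      m∘inj q = ≈-trans (pullˡ (∐P.copair∘inj i))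
                        (≈-trans (value-i ⟩∘ _) (pb.p₂∘universal i))

  +-ext : ∀ {A B T S} (t : T ⇒ A + B) {r s : T ⇒ S} →
    (∀ {V} (v : V ⇒ T) (w : V ⇒ A) → t ∘ v ≈ i₁ ∘ w → r ∘ v ≈ s ∘ v) →
    (∀ {V} (v : V ⇒ T) (w : V ⇒ B) → t ∘ v ≈ i₂ ∘ w → r ∘ v ≈ s ∘ v) →
    r ≈ s
  +-ext t p q = case-ext (fin 2) t λ { zero → p ; (suc zero) → q }

  +-disjoint : ∀ {A B V} {a : V ⇒ A} {b : V ⇒ B} → i₁ ∘ a ≈ i₂ ∘ b →
    ∀ {S} (r s : V ⇒ S) → r ≈ s
  +-disjoint = inj-disjoint (fin 2) λ ()

  i₁-mono : ∀ {A B} → Mono (i₁ {A} {B})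
  i₁-mono = inj-mono (fin 2) zero

  i₂-mono : ∀ {A B} → Mono (i₂ {A} {B})
  i₂-mono = inj-mono (fin 2) (suc zero)

  num-ext : ∀ {T S} (t : T ⇒ N) {r s : T ⇒ S} →
    (∀ n {V} (v : V ⇒ T) → t ∘ v ≈ num n ∘ ! → r ∘ v ≈ s ∘ v) → r ≈ s
  num-ext t p = case-ext ω t λ n v w q → p n v (≈-trans q (_ ∘⟨ !-unique w))

  -- Loops on fixed points, numbered elements, and the state inclusion.

  ^-fixed : ∀ {Z T} {g : Z ⇒ Z} {a : T ⇒ Z} → g ∘ a ≈ a → ∀ n → (g ^ n) ∘ a ≈ a
  ^-fixed p zero    = identityˡ
  ^-fixed p (suc n) = ≈-trans (pullʳ (^-fixed p n)) p

  fromRows∘⟨num,⟩ : ∀ {Z T V} (a : ℕ → Z ⇒ T) n {c : V ⇒ N} {z w : V ⇒ Z} →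
    c ≈ num n ∘ ! → w ≈ z → fromRows a ∘ ⟨ c , w ⟩ ≈ a n ∘ z
  fromRows∘⟨num,⟩ a n {z = z} p q = ≈-trans
    (_ ∘⟨ ≈-trans (⟨⟩-cong p q) (⟨num,⟩ n z)) (pullˡ (fromRows∘row a n))

  -- Split both elements by summand: in matching cases the injections cancel, and mixed cases would
  -- put an element of X into U + Y.
  stateInclusion-mono : ∀ {X U Y} → Mono (stateInclusion {X} {U} {Y})
  stateInclusion-mono a b p =
    +-ext a
      (λ v x av → +-ext (b ∘ v)
        (λ v′ x′ bv → conclude av bv (i₁-mono _ _ (both inject₁ inject₁ av bv)))
        (λ v′ y′ bv → +-disjoint (both inject₁ inject₂ av bv ⟨≈⟩ assoc) _ _))
      (λ v y av → +-ext (b ∘ v)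
        (λ v′ x′ bv → +-disjoint (≈-sym (both inject₂ inject₁ av bv) ⟨≈⟩ assoc) _ _)
        (λ v′ y′ bv → conclude av bv (i₂-mono _ _ (i₂-mono _ _
          (≈-sym assoc ⟨≈⟩ (both inject₂ inject₂ av bv ⟨≈⟩ assoc))))))
    where
      both : ∀ {V V′ A B} {v : V ⇒ _} {v′ : V′ ⇒ V} {i : A ⇒ _} {j : B ⇒ _} {i′ j′}
        {x : V ⇒ A} {x′ : V′ ⇒ B} →
        stateInclusion ∘ i ≈ i′ → stateInclusion ∘ j ≈ j′ →
        a ∘ v ≈ i ∘ x → (b ∘ v) ∘ v′ ≈ j ∘ x′ → i′ ∘ (x ∘ v′) ≈ j′ ∘ x′
      both {v = v} {v′} {i} {j} {i′} {j′} {x} {x′} ci cj av bv = begin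
        i′ ∘ (x ∘ v′)                      ≈⟨ ci ⟩∘ _ ⟨
        (stateInclusion ∘ i) ∘ (x ∘ v′)    ≈⟨ pullʳ (pullˡ (≈-sym av)) ⟩
        stateInclusion ∘ ((a ∘ v) ∘ v′)    ≈⟨ _ ∘⟨ assoc ⟩
        stateInclusion ∘ (a ∘ (v ∘ v′))    ≈⟨ pullˡ p ⟩
        (stateInclusion ∘ b) ∘ (v ∘ v′)    ≈⟨ pullʳ (≈-sym assoc) ⟩
        stateInclusion ∘ ((b ∘ v) ∘ v′)    ≈⟨ _ ∘⟨ bv ⟩
        stateInclusion ∘ (j ∘ x′)          ≈⟨ pullˡ cj ⟩
        j′ ∘ x′                            ∎
      conclude : ∀ {V V′ A} {v : V ⇒ _} {v′ : V′ ⇒ V} {i : A ⇒ _} {x : V ⇒ A} {x′ : V′ ⇒ A} →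
        a ∘ v ≈ i ∘ x → (b ∘ v) ∘ v′ ≈ i ∘ x′ → x ∘ v′ ≈ x′ → (a ∘ v) ∘ v′ ≈ (b ∘ v) ∘ v′
      conclude av bv q = ≈-trans (≈-trans (av ⟩∘ _) assoc) (≈-trans (_ ∘⟨ q) (≈-sym bv))

  -- Full inclusions of internal categories, and composition in coordinates.

  pullback-mono : ∀ {A B C} {f : A ⇒ C} {g : B ⇒ C} (pb : Pullback 𝔈 f g) →
    Mono g → Mono (Pullback.p₁ pb)
  pullback-mono {f = f} {g} pb g-mono r s p = universal-cong pb p (g-mono _ _ (begin
    g ∘ (p₂ ∘ r)   ≈⟨ pullˡ (≈-sym commute) ⟩
    (f ∘ p₁) ∘ r   ≈⟨ pullʳ p ⟩
    f ∘ (p₁ ∘ s)   ≈⟨ pullˡ commute ⟩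
    (g ∘ p₂) ∘ s   ≈⟨ assoc ⟩
    g ∘ (p₂ ∘ s)   ∎))
    where open Pullback pb

  module _ {C D : InternalCategory} (F : InternalFunctor C D)
           (F₀-mono : Mono (InternalFunctor.F₀ F)) where
    private
      module C = InternalCategory C
      module D = InternalCategory D
    open InternalFunctor F

    -- For fullness it suffices that F₁ covers, up to splitting into cases, each
    -- generalized arrow of D with endpoints in the image of F₀.
    factorization-epi :
      (∀ {T S} (a : T ⇒ D.C₁) (z z′ : T ⇒ C.C₀) →
        D.∂₀ ∘ a ≈ F₀ ∘ z → D.∂₁ ∘ a ≈ F₀ ∘ z′ → {r s : T ⇒ S} →
        (∀ {V} (v : V ⇒ T) (x : V ⇒ C.C₁) → a ∘ v ≈ F₁ ∘ x → r ∘ v ≈ s ∘ v) → r ≈ s) →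
      Epi factorization
    factorization-epi cover r s p = cover
      underlying (∂₀⁻¹F₀.p₂ ∘ ∩.p₁) (∂₁⁻¹F₀.p₂ ∘ ∩.p₂)
      (≈-trans (pullˡ ∂₀⁻¹F₀.commute) assoc)
      (≈-trans (_ ∘⟨ ∩.commute) (≈-trans (pullˡ ∂₁⁻¹F₀.commute) assoc))
      λ v x q →
        let v≈ = underlying-mono _ _ (≈-trans q (≈-sym (pullˡ underlying∘factorization)))
        in begin
          r ∘ v                      ≈⟨ r ∘⟨ v≈ ⟩
          r ∘ (factorization ∘ x)    ≈⟨ pullˡ p ⟩
          (s ∘ factorization) ∘ x    ≈⟨ pullʳ (≈-sym v≈) ⟩
          s ∘ v                      ∎
      where
        underlying : ∩.P ⇒ D.C₁
        underlying = ∂₀⁻¹F₀.p₁ ∘ ∩.p₁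

        underlying-mono : Mono underlying
        underlying-mono r s p =
          pullback-mono (pullback _ _) (pullback-mono (pullback _ _) F₀-mono) r s
            (pullback-mono (pullback _ _) F₀-mono _ _
              (≈-trans (≈-sym assoc) (≈-trans p assoc)))

        underlying∘factorization : underlying ∘ factorization ≈ F₁
        underlying∘factorization = ≈-trans (pullʳ ∩.p₁∘universal) ∂₀⁻¹F₀.p₁∘universal

  refinement : ∀ {𝐌 𝐌′} {𝐙 : Automaton 𝐌} {𝐙′ : Automaton 𝐌′}
    (F : InternalFunctor (Trans 𝐙) (Trans 𝐙′)) →
    let module 𝐙  = InternalCategory (Trans 𝐙)
        module 𝐙′ = InternalCategory (Trans 𝐙′)
        open InternalFunctor F in
    Mono F₀ → Mono F₁ →
    (∀ {T S} (a : T ⇒ 𝐙′.C₁) (z z′ : T ⇒ 𝐙.C₀) →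
      𝐙′.∂₀ ∘ a ≈ F₀ ∘ z → 𝐙′.∂₁ ∘ a ≈ F₀ ∘ z′ → {r s : T ⇒ S} →
      (∀ {V} (v : V ⇒ T) (x : V ⇒ 𝐙.C₁) → a ∘ v ≈ F₁ ∘ x → r ∘ v ≈ s ∘ v) → r ≈ s) →
    Refinement 𝐙 𝐙′
  refinement F F₀-mono F₁-mono cover = record
    { functor   = F
    ; injective = F₀-mono
    ; faithful  = F₁-mono
    ; full      = factorization-epi F F₀-mono cover
    }

  comp∘universal : ∀ {𝐌} (𝐙 : Automaton 𝐌) →
    let open MonoidObject 𝐌
        open Automaton 𝐙
        open InternalCategory (Trans 𝐙) in
    ∀ {T} {b a : T ⇒ M × Z} (p : π₂ ∘ b ≈ α ∘ a) →
    comp ∘ C₂.universal p ≈ ⟨ μ ∘ ⟨ π₁ ∘ b , π₁ ∘ a ⟩ , π₂ ∘ a ⟩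
  comp∘universal 𝐙 p = ≈-trans ⟨⟩∘ (⟨⟩-cong
    (pullʳ (≈-trans ⟨⟩∘ (⟨⟩-cong (pullʳ C₂.p₁∘universal) (pullʳ C₂.p₂∘universal))))
    (pullʳ C₂.p₂∘universal))
    where open InternalCategory (Trans 𝐙)

  -- Runs of the functional processor.

  module _ {X U Y : Obj} (f : X + U ⇒ U + Y) where
    open Iteration f

    private
      ι : X + Y ⇒ X + (U + Y)
      ι = stateInclusion
      h = processorLoop

    processorLoop∘i₁ : h ∘ i₁ ≈ i₂ ∘ f∣X
    processorLoop∘i₁ = pullʳ (pullʳ inject₁ ⟨≈⟩ pullˡ inject₁)

    processorLoop∘i₂i₁ : h ∘ (i₂ ∘ i₁) ≈ i₂ ∘ f∣U
    processorLoop∘i₂i₁ = pullʳ (≈-trans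
      (pullʳ (≈-trans (pullˡ inject₂) inject₁)) (pullˡ inject₁))

    processorLoop∘i₂i₂ : h ∘ (i₂ ∘ i₂) ≈ i₂ ∘ i₂
    processorLoop∘i₂i₂ = pullʳ (≈-trans
      (pullʳ (≈-trans (pullˡ inject₂) inject₂)) inject₂)

    -- The exponent is `suc k` because `f⟨ 0 ⟩` already takes one step. On `Dom (suc k)` the value
    -- of `f⟨ k ⟩` lies in U, where the next step of `h` applies `f∣U`.
    loop-f⟨⟩ : ∀ k → (h ^ suc k) ∘ (i₁ ∘ inclusion k) ≈ i₂ ∘ f⟨ k ⟩
    loop-f⟨⟩ zero = begin
      (h ∘ id) ∘ (i₁ ∘ id)   ≈⟨ ∘-resp-≈ identityʳ identityʳ ⟩
      h ∘ i₁                 ≈⟨ processorLoop∘i₁ ⟩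
      i₂ ∘ f∣X               ∎
    loop-f⟨⟩ (suc k) = begin
      (h ∘ (h ^ suc k)) ∘ (i₁ ∘ (inclusion k ∘ p₁))   ≈⟨ pullʳ (_ ∘⟨ ≈-sym assoc) ⟩
      h ∘ ((h ^ suc k) ∘ ((i₁ ∘ inclusion k) ∘ p₁))   ≈⟨ h ∘⟨ pullˡ (loop-f⟨⟩ k) ⟩
      h ∘ ((i₂ ∘ f⟨ k ⟩) ∘ p₁)                        ≈⟨ h ∘⟨ pullʳ commute ⟩
      h ∘ (i₂ ∘ (i₁ ∘ p₂))                            ≈⟨ h ∘⟨ assoc ⟨
      h ∘ ((i₂ ∘ i₁) ∘ p₂)                            ≈⟨ pullˡ processorLoop∘i₂i₁ ⟩
      (i₂ ∘ f∣U) ∘ p₂                                 ≈⟨ assoc ⟩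
      i₂ ∘ f⟨ suc k ⟩                                 ∎
      where open Pb f⟨ k ⟩ i₁

    -- `Dom (suc j)` is the pullback on which `f⟨ j ⟩` lands in U, and for `j <′ k` the inclusion of
    -- `Dom k` passes through it.
    loop-running : ∀ k {j} → j <′ k →
      ∃[ u ] (h ^ suc j) ∘ (i₁ ∘ inclusion k) ≈ i₂ ∘ (i₁ ∘ u)
    loop-running (suc k) <′-base = Pb.p₂ f⟨ k ⟩ i₁ , (begin
      (h ^ suc k) ∘ (i₁ ∘ (inclusion k ∘ p₁))   ≈⟨ _ ∘⟨ assoc ⟨
      (h ^ suc k) ∘ ((i₁ ∘ inclusion k) ∘ p₁)   ≈⟨ pullˡ (loop-f⟨⟩ k) ⟩
      (i₂ ∘ f⟨ k ⟩) ∘ p₁                        ≈⟨ pullʳ commute ⟩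
      i₂ ∘ (i₁ ∘ p₂)                            ∎)
      where open Pb f⟨ k ⟩ i₁
    loop-running (suc k) {j} (≤′-step j<k) with u , p ← loop-running k j<k =
      u ∘ p₁ , (begin
      (h ^ suc j) ∘ (i₁ ∘ (inclusion k ∘ p₁))   ≈⟨ _ ∘⟨ assoc ⟨
      (h ^ suc j) ∘ ((i₁ ∘ inclusion k) ∘ p₁)   ≈⟨ pullˡ p ⟩
      (i₂ ∘ (i₁ ∘ u)) ∘ p₁                      ≈⟨ pullʳ assoc ⟩
      i₂ ∘ (i₁ ∘ (u ∘ p₁))                      ∎)
      where open Pb f⟨ k ⟩ i₁

    -- Settling times of elements of X + Y.

    module _ (t : Terminating) where
      private
        module t = IsIso t
        g = calledLoop t
        module 𝕏  = Automaton (loopAutomaton g)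
        module 𝕏′ = Automaton (loopAutomaton h)

      exit : ∀ k → Exit k ⇒ X
      exit k = inclusion k ∘ Pb.p₁ f⟨ k ⟩ i₂

      t⁻¹∘exit : ∀ k → t.inv ∘ exit k ≈ ∐.inj ω Exit k
      t⁻¹∘exit k = begin
        t.inv ∘ exit k                    ≈⟨ _ ∘⟨ ∐.copair∘inj ω Exit k ⟨
        t.inv ∘ (exits ∘ ∐.inj ω Exit k)  ≈⟨ pullˡ t.isoˡ ⟩
        id ∘ ∐.inj ω Exit k               ≈⟨ identityˡ ⟩
        ∐.inj ω Exit k                    ∎

      copair∘t⁻¹∘exit : ∀ {T} (a : ∀ k → Exit k ⇒ T) k →
        (∐.copair ω Exit a ∘ t.inv) ∘ exit k ≈ a k
      copair∘t⁻¹∘exit a k = ≈-trans (pullʳ (t⁻¹∘exit k)) (∐.copair∘inj ω Exit k)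

      -- Termination becomes case analysis here: `t.inv` maps X into the sum of the `Exit k`, so
      -- splitting along it splits elements of X by exit stage.
      exit-ext : ∀ {T S} (x : T ⇒ X) {r s : T ⇒ S} →
        (∀ k {V} (v : V ⇒ T) (w : V ⇒ Exit k) → x ∘ v ≈ exit k ∘ w → r ∘ v ≈ s ∘ v) →
        r ≈ s
      exit-ext x p = case-ext ω (t.inv ∘ x) λ k v w q → p k v w (begin
        x ∘ v                          ≈⟨ identityˡ ⟨
        id ∘ (x ∘ v)                   ≈⟨ t.isoʳ ⟩∘ _ ⟨
        (exits ∘ t.inv) ∘ (x ∘ v)      ≈⟨ pullʳ (≈-trans (≈-sym assoc) q) ⟩
        exits ∘ (∐.inj ω Exit k ∘ w)   ≈⟨ pullˡ (∐.copair∘inj ω Exit k) ⟩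
        exit k ∘ w                     ∎)

      -- The number of steps of h that n steps of g amount to.
      steps : ℕ → X + Y ⇒ N
      steps n = [ ∐.copair ω Exit (λ k → num (delay n k) ∘ !) ∘ t.inv , num n ∘ ! ]

      -- The generalized element z reaches its value under g after exactly
      -- k + 1 steps of h (for z in Y, k = 0), passing only through U before.
      record Settles {T} (z : T ⇒ X + Y) (k : ℕ) : Set (ℓ ⊔ e) where
        field
          result  : T ⇒ Y
          counted : ∀ n → steps n ∘ z ≈ num (delay n k) ∘ !
          called  : g ∘ z ≈ i₂ ∘ result
          settled : (h ^ suc k) ∘ (ι ∘ z) ≈ i₂ ∘ (i₂ ∘ result)
          running : ∀ {j} → j <′ k → ∃[ u ] (h ^ suc j) ∘ (ι ∘ z) ≈ i₂ ∘ (i₁ ∘ u)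

      -- The pullback square of `Exit k` turns `loop-f⟨⟩` into `settled`, and its second projection
      -- is also the value of `call t` on that summand.
      settles-exit : ∀ {T} {z : T ⇒ X + Y} k (w : T ⇒ Exit k) →
        z ≈ i₁ ∘ (exit k ∘ w) → Settles z k
      settles-exit {z = z} k w p = record
        { result  = p₂ ∘ w
        ; counted = λ n → begin
            steps n ∘ z                       ≈⟨ _ ∘⟨ p ⟩
            steps n ∘ (i₁ ∘ (exit k ∘ w))     ≈⟨ pullˡ inject₁ ⟩
            _ ∘ (exit k ∘ w)                  ≈⟨ pullˡ (copair∘t⁻¹∘exit _ k) ⟩
            (num (delay n k) ∘ !) ∘ w         ≈⟨ pullʳ !-unique₂ ⟩
            num (delay n k) ∘ !               ∎
        ; called  = begin
            g ∘ z                                     ≈⟨ _ ∘⟨ p ⟩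
            (i₂ ∘ [ call t , id ]) ∘ (i₁ ∘ (exit k ∘ w)) ≈⟨ pullʳ (pullˡ inject₁) ⟩
            i₂ ∘ (call t ∘ (exit k ∘ w))              ≈⟨ _ ∘⟨ pullˡ (copair∘t⁻¹∘exit _ k) ⟩
            i₂ ∘ (p₂ ∘ w)                             ∎
        ; settled = begin
            (h ^ suc k) ∘ (ι ∘ z)                             ≈⟨ _ ∘⟨ ι∘z ⟩
            (h ^ suc k) ∘ ((i₁ ∘ inclusion k) ∘ (p₁ ∘ w))     ≈⟨ pullˡ (loop-f⟨⟩ k) ⟩
            (i₂ ∘ f⟨ k ⟩) ∘ (p₁ ∘ w)                          ≈⟨ pullʳ (pullˡ commute) ⟩
            i₂ ∘ ((i₂ ∘ p₂) ∘ w)                              ≈⟨ _ ∘⟨ assoc ⟩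
            i₂ ∘ (i₂ ∘ (p₂ ∘ w))                              ∎
        ; running = λ {j} j<k → let u , q = loop-running k j<k in u ∘ (p₁ ∘ w) , (begin
            (h ^ suc j) ∘ (ι ∘ z)                             ≈⟨ _ ∘⟨ ι∘z ⟩
            (h ^ suc j) ∘ ((i₁ ∘ inclusion k) ∘ (p₁ ∘ w))     ≈⟨ pullˡ q ⟩
            (i₂ ∘ (i₁ ∘ u)) ∘ (p₁ ∘ w)                        ≈⟨ pullʳ assoc ⟩
            i₂ ∘ (i₁ ∘ (u ∘ (p₁ ∘ w)))                        ∎)
        }
        where
          open Pb f⟨ k ⟩ i₂
          ι∘z : ι ∘ z ≈ (i₁ ∘ inclusion k) ∘ (p₁ ∘ w)
          ι∘z = begin
            ι ∘ z                                 ≈⟨ ι ∘⟨ p ⟩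
            ι ∘ (i₁ ∘ (exit k ∘ w))               ≈⟨ pullˡ inject₁ ⟩
            i₁ ∘ ((inclusion k ∘ p₁) ∘ w)         ≈⟨ _ ∘⟨ assoc ⟩
            i₁ ∘ (inclusion k ∘ (p₁ ∘ w))         ≈⟨ assoc ⟨
            (i₁ ∘ inclusion k) ∘ (p₁ ∘ w)         ∎

      calledLoop∘i₂ : g ∘ i₂ ≈ i₂
      calledLoop∘i₂ = ≈-trans (pullʳ inject₂) identityʳ

      settles-Y : ∀ {T} {z : T ⇒ X + Y} (y : T ⇒ Y) → z ≈ i₂ ∘ y → Settles z 0
      settles-Y {z = z} y p = record
        { result  = y
        ; counted = λ n → begin
            steps n ∘ z           ≈⟨ _ ∘⟨ p ⟩
            steps n ∘ (i₂ ∘ y)    ≈⟨ pullˡ inject₂ ⟩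
            (num n ∘ !) ∘ y       ≈⟨ pullʳ !-unique₂ ⟩
            num n ∘ !             ≈⟨ num-cong (delay-zero n) ⟩∘ _ ⟨
            num (delay n 0) ∘ !   ∎
        ; called  = ≈-trans (_ ∘⟨ p) (pullˡ calledLoop∘i₂)
        ; settled = begin
            (h ∘ id) ∘ (ι ∘ z)          ≈⟨ ∘-resp-≈ identityʳ (≈-trans (_ ∘⟨ p) (pullˡ inject₂)) ⟩
            h ∘ ((i₂ ∘ i₂) ∘ y)         ≈⟨ pullˡ processorLoop∘i₂i₂ ⟩
            (i₂ ∘ i₂) ∘ y               ≈⟨ assoc ⟩
            i₂ ∘ (i₂ ∘ y)               ∎
        ; running = λ { (≤′-reflexive ()) }
        }

      -- Every element settles locally: one of X after splitting by exit stage, one of Y with `k`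
      -- equal to 0.
      settle-ext : ∀ {T S} (z : T ⇒ X + Y) {r s : T ⇒ S} →
        (∀ k {V} (v : V ⇒ T) → Settles (z ∘ v) k → r ∘ v ≈ s ∘ v) → r ≈ s
      settle-ext z p = +-ext z
        (λ v x zv → exit-ext x λ k v′ w xv′ →
          ≈-trans assoc (≈-trans
            (p k (v ∘ v′) (settles-exit k w
              (≈-trans (≈-sym assoc) (≈-trans (zv ⟩∘ v′) (pullʳ xv′)))))
            (≈-sym assoc)))
        (λ v y zv → p 0 v (settles-Y y zv))

      settles-resp : ∀ {T} {z z′ : T ⇒ X + Y} {k} → z ≈ z′ → Settles z k → Settles z′ k
      settles-resp p s = record
        { result  = result
        ; counted = λ n → ≈-trans (_ ∘⟨ ≈-sym p) (counted n)
        ; called  = ≈-trans (_ ∘⟨ ≈-sym p) called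
        ; settled = ≈-trans (_ ∘⟨ (_ ∘⟨ ≈-sym p)) settled
        ; running = λ j<k → let u , q = running j<k in
            u , ≈-trans (_ ∘⟨ (_ ∘⟨ ≈-sym p)) q
        }
        where open Settles s

      module _ {T} {z : T ⇒ X + Y} {k} (s : Settles z k) where
        open Settles s

        g^suc : ∀ n → (g ^ suc n) ∘ z ≈ i₂ ∘ result
        g^suc zero    = ≈-trans (identityʳ ⟩∘ _) called
        g^suc (suc n) = ≈-trans (pullʳ (g^suc n)) (pullˡ calledLoop∘i₂)

        h^delay : ∀ n → (h ^ delay n k) ∘ (ι ∘ z) ≈ ι ∘ ((g ^ n) ∘ z)
        h^delay zero    = ≈-trans identityˡ (ι ∘⟨ ≈-sym identityˡ)
        -- The first `suc k` steps of `h` reach the result that `g` reaches in one step; from there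
        -- on both loops fix Y.
        h^delay (suc n) = begin
          (h ^ (n +ℕ suc k)) ∘ (ι ∘ z)             ≈⟨ ^-+ h n (suc k) ⟩∘ _ ⟩
          ((h ^ n) ∘ (h ^ suc k)) ∘ (ι ∘ z)        ≈⟨ pullʳ (≈-trans settled (≈-sym assoc)) ⟩
          (h ^ n) ∘ ((i₂ ∘ i₂) ∘ result)           ≈⟨ pullˡ (^-fixed processorLoop∘i₂i₂ n) ⟩
          (i₂ ∘ i₂) ∘ result                       ≈⟨ pullˡ inject₂ ⟨
          ι ∘ (i₂ ∘ result)                        ≈⟨ ι ∘⟨ g^suc n ⟨
          ι ∘ ((g ^ suc n) ∘ z)                    ∎

        -- The cocycle identity behind functoriality: `d` counts `n` steps of `g` from `z`, and `c`
        -- counts `m` more from where they end. For `n` positive that point is in Y, so the delay of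
        -- `z` is charged only once.
        steps-+ : ∀ m n {c d : T ⇒ N} →
          c ≈ steps m ∘ ((g ^ n) ∘ z) → d ≈ num (delay n k) ∘ ! →
          steps (m +ℕ n) ∘ z ≈ μN ∘ ⟨ c , d ⟩
        steps-+ m zero {c} {d} p q = begin
          steps (m +ℕ 0) ∘ z                        ≈⟨ counted (m +ℕ 0) ⟩
          num (delay (m +ℕ 0) k) ∘ !                ≈⟨ num-cong eq ⟩∘ _ ⟩
          num (delay m k +ℕ 0) ∘ !                  ≈⟨ μN∘⟨num,num⟩ (delay m k) 0 ⟨
          μN ∘ ⟨ num (delay m k) ∘ ! , num 0 ∘ ! ⟩  ≈⟨ μN ∘⟨ ⟨⟩-cong (≈-trans p
            (≈-trans (_ ∘⟨ identityˡ) (counted m))) q ⟨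
          μN ∘ ⟨ c , d ⟩                            ∎
          where
            eq : delay (m +ℕ 0) k ≡ delay m k +ℕ 0
            eq = ≡.trans (≡.cong (λ m → delay m k) (ℕₚ.+-identityʳ m))
                         (≡.sym (ℕₚ.+-identityʳ _))
        steps-+ m (suc n) {c} {d} p q = begin
          steps (m +ℕ suc n) ∘ z                    ≈⟨ counted (m +ℕ suc n) ⟩
          num (delay (m +ℕ suc n) k) ∘ !            ≈⟨ num-cong (delay-+-suc m n k) ⟩∘ _ ⟩
          num (m +ℕ delay (suc n) k) ∘ !            ≈⟨ μN∘⟨num,num⟩ m (delay (suc n) k) ⟨
          μN ∘ ⟨ num m ∘ ! , num (delay (suc n) k) ∘ ! ⟩  ≈⟨ μN ∘⟨ ⟨⟩-cong c≈ q ⟨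
          μN ∘ ⟨ c , d ⟩                            ∎
          where
            c≈ : c ≈ num m ∘ !
            c≈ = begin
              c                               ≈⟨ p ⟩
              steps m ∘ ((g ^ suc n) ∘ z)     ≈⟨ _ ∘⟨ g^suc n ⟩
              steps m ∘ (i₂ ∘ result)         ≈⟨ pullˡ inject₂ ⟩
              (num m ∘ !) ∘ result            ≈⟨ pullʳ !-unique₂ ⟩
              num m ∘ !                       ∎

      -- The arrow component F₁: targets, identities and step counts of composites.

      arrows : N × (X + Y) ⇒ N × (X + (U + Y))
      arrows = ⟨ fromRows steps , ι ∘ π₂ ⟩

      -- A local normal form for generalized arrows of the first transition category: a fixed
      -- numeral, with a source of known settling time. `arrow-ext` reduces equations to this form.
      record IsArrow {T} (a : T ⇒ N × (X + Y)) (n k : ℕ) : Set (ℓ ⊔ e) where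
        constructor isArrow
        field
          number  : π₁ ∘ a ≈ num n ∘ !
          settles : Settles (π₂ ∘ a) k
        a≈row : a ≈ row n ∘ (π₂ ∘ a)
        a≈row = ≈-trans (≈-sym ⟨π₁∘,π₂∘⟩) (≈-trans (⟨⟩-cong number ≈-refl) (⟨num,⟩ n _))
        open Settles settles

        α∘ : 𝕏.α ∘ a ≈ (g ^ n) ∘ (π₂ ∘ a)
        α∘ = ≈-trans (_ ∘⟨ a≈row) (pullˡ (fromRows∘row (g ^_) n))

        steps∘ : fromRows steps ∘ a ≈ steps n ∘ (π₂ ∘ a)
        steps∘ = ≈-trans (_ ∘⟨ a≈row) (pullˡ (fromRows∘row steps n))

        arrows∘ : arrows ∘ a ≈ row (delay n k) ∘ (ι ∘ (π₂ ∘ a))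
        arrows∘ = ≈-trans ⟨⟩∘ (≈-trans
          (⟨⟩-cong (≈-trans steps∘ (counted n)) assoc) (⟨num,⟩ _ _))

      arrow-ext : ∀ {T S} (a : T ⇒ N × (X + Y)) {r s : T ⇒ S} →
        (∀ n k {V} (v : V ⇒ T) → IsArrow (a ∘ v) n k → r ∘ v ≈ s ∘ v) → r ≈ s
      arrow-ext a p = num-ext (π₁ ∘ a) λ n v av → settle-ext (π₂ ∘ (a ∘ v)) λ k w s →
        ≈-trans assoc (≈-trans
          (p n k (v ∘ w) (isArrow
            (begin
              π₁ ∘ (a ∘ (v ∘ w))      ≈⟨ _ ∘⟨ assoc ⟨
              π₁ ∘ ((a ∘ v) ∘ w)      ≈⟨ pullˡ (≈-trans (≈-sym assoc) av) ⟩
              (num n ∘ !) ∘ w         ≈⟨ pullʳ !-unique₂ ⟩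
              num n ∘ !               ∎)
            (settles-resp (≈-trans assoc (_ ∘⟨ assoc)) s)))
          (≈-sym assoc))

      arrows-∂₁ : 𝕏′.α ∘ arrows ≈ ι ∘ 𝕏.α
      -- The arrow being split is the generic one, `id`, which leaves the composites `id ∘ v` to be
      -- removed.
      arrows-∂₁ = arrow-ext id λ n k v a → let open IsArrow a in begin
        (𝕏′.α ∘ arrows) ∘ v                             ≈⟨ pullʳ (_ ∘⟨ ≈-sym identityˡ) ⟩
        𝕏′.α ∘ (arrows ∘ (id ∘ v))                      ≈⟨ _ ∘⟨ arrows∘ ⟩
        𝕏′.α ∘ (row (delay n k) ∘ (ι ∘ (π₂ ∘ (id ∘ v))))  ≈⟨ pullˡ (fromRows∘row (h ^_) _) ⟩
        (h ^ delay n k) ∘ (ι ∘ (π₂ ∘ (id ∘ v)))         ≈⟨ h^delay settles n ⟩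
        ι ∘ ((g ^ n) ∘ (π₂ ∘ (id ∘ v)))                 ≈⟨ _ ∘⟨ α∘ ⟨
        ι ∘ (𝕏.α ∘ (id ∘ v))                            ≈⟨ _ ∘⟨ (_ ∘⟨ identityˡ) ⟩
        ι ∘ (𝕏.α ∘ v)                                   ≈⟨ assoc ⟨
        (ι ∘ 𝕏.α) ∘ v                                   ∎

      -- Identities are preserved because `delay 0 k` is 0 whatever the settling time `k`.
      arrows-ide : arrows ∘ row 0 ≈ row 0 ∘ ι
      arrows-ide = settle-ext id λ k v s → let open Settles s in begin
        (arrows ∘ row 0) ∘ v                            ≈⟨ ⟨⟩∘ ⟩∘ v ⟩
        ⟨ fromRows steps ∘ row 0 , (ι ∘ π₂) ∘ row 0 ⟩ ∘ v  ≈⟨ ⟨⟩-cong (fromRows∘row steps 0)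
          (≈-trans (pullʳ π₂∘⟨⟩) identityʳ) ⟩∘ v ⟩
        ⟨ steps 0 , ι ⟩ ∘ v                             ≈⟨ ⟨⟩∘ ⟩
        ⟨ steps 0 ∘ v , ι ∘ v ⟩                         ≈⟨ ⟨⟩-cong
          (≈-trans (_ ∘⟨ ≈-sym identityˡ) (counted 0)) ≈-refl ⟩
        ⟨ num 0 ∘ ! , ι ∘ v ⟩                           ≈⟨ ⟨num,⟩ 0 (ι ∘ v) ⟩
        row 0 ∘ (ι ∘ v)                                 ≈⟨ assoc ⟨
        (row 0 ∘ ι) ∘ v                                 ∎

      number-∘ : ∀ {T V W} {a : T ⇒ N × (X + Y)} {v : V ⇒ T} (w : W ⇒ V) {n} →
        (π₁ ∘ a) ∘ v ≈ num n ∘ ! → π₁ ∘ ((a ∘ v) ∘ w) ≈ num n ∘ !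
      number-∘ {a = a} {v} w {n} p = begin
        π₁ ∘ ((a ∘ v) ∘ w)   ≈⟨ pullˡ (≈-trans (≈-sym assoc) p) ⟩
        (num n ∘ !) ∘ w      ≈⟨ pullʳ !-unique₂ ⟩
        num n ∘ !            ∎

      module _ {T} (b a : T ⇒ N × (X + Y)) where
        -- Composition in coordinates, defined even for non-composable pairs so that restricting it
        -- to a case requires no proof of composability.
        composite : T ⇒ N × (X + Y)
        composite = ⟨ μN ∘ ⟨ π₁ ∘ b , π₁ ∘ a ⟩ , π₂ ∘ a ⟩

        composite∘ : ∀ {V} (v : V ⇒ T) →
          composite ∘ v ≈ ⟨ μN ∘ ⟨ π₁ ∘ (b ∘ v) , π₁ ∘ (a ∘ v) ⟩ , π₂ ∘ (a ∘ v) ⟩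
        composite∘ v = ≈-trans ⟨⟩∘ (⟨⟩-cong
          (pullʳ (≈-trans ⟨⟩∘ (⟨⟩-cong assoc assoc))) assoc)

        stepsSum : T ⇒ N
        stepsSum = μN ∘ ⟨ fromRows steps ∘ b , fromRows steps ∘ a ⟩

        stepsSum∘ : ∀ {V} (v : V ⇒ T) →
          stepsSum ∘ v ≈ μN ∘ ⟨ fromRows steps ∘ (b ∘ v) , fromRows steps ∘ (a ∘ v) ⟩
        stepsSum∘ v = pullʳ (≈-trans ⟨⟩∘ (⟨⟩-cong assoc assoc))

        -- Only the numeral of `b` has to be fixed: its source is the target of `a`, so its step
        -- count is determined by how the source of `a` settles.
        steps-composite-at : ∀ {m n k} → π₁ ∘ b ≈ num m ∘ ! → IsArrow a n k →
          π₂ ∘ b ≈ 𝕏.α ∘ a → fromRows steps ∘ composite ≈ stepsSum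
        steps-composite-at {m} {n} pb ia p = begin
          fromRows steps ∘ composite      ≈⟨ fromRows∘⟨num,⟩ steps (m +ℕ n)
            (≈-trans (μN ∘⟨ ⟨⟩-cong pb number) (μN∘⟨num,num⟩ m n)) ≈-refl ⟩
          steps (m +ℕ n) ∘ (π₂ ∘ a)       ≈⟨ steps-+ settles m n
            (begin
              fromRows steps ∘ b                ≈⟨ _ ∘⟨ ⟨π₁∘,π₂∘⟩ ⟨
              fromRows steps ∘ ⟨ π₁ ∘ b , π₂ ∘ b ⟩  ≈⟨ fromRows∘⟨num,⟩ steps m pb (≈-trans p α∘) ⟩
              steps m ∘ ((g ^ n) ∘ (π₂ ∘ a))    ∎)
            (≈-trans steps∘ (Settles.counted settles n)) ⟩
          stepsSum                        ∎
          where open IsArrow ia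

      steps-composite : ∀ {T} (b a : T ⇒ N × (X + Y)) → π₂ ∘ b ≈ 𝕏.α ∘ a →
        fromRows steps ∘ composite b a ≈ stepsSum b a
      steps-composite b a p = num-ext (π₁ ∘ b) λ m v bv →
        restrict b a v (arrow-ext (a ∘ v) λ n k w ia →
          restrict (b ∘ v) (a ∘ v) w
            (steps-composite-at _ _ (number-∘ w bv) ia
              (precompose (b ∘ v) (a ∘ v) w (precompose b a v p))))
        where
          precompose : ∀ {T V} (b a : T ⇒ N × (X + Y)) (v : V ⇒ T) →
            π₂ ∘ b ≈ 𝕏.α ∘ a → π₂ ∘ (b ∘ v) ≈ 𝕏.α ∘ (a ∘ v)
          precompose b a v p = ≈-trans (pullˡ p) assoc
          restrict : ∀ {T V} (b a : T ⇒ N × (X + Y)) (v : V ⇒ T) →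
            fromRows steps ∘ composite (b ∘ v) (a ∘ v) ≈ stepsSum (b ∘ v) (a ∘ v) →
            (fromRows steps ∘ composite b a) ∘ v ≈ stepsSum b a ∘ v
          restrict b a v q = ≈-trans (pullʳ (composite∘ b a v))
            (≈-trans q (≈-sym (stepsSum∘ b a v)))

      -- Faithfulness and preservation of composition.

      -- With a common source and settling time, different numerals have different delays. Equal
      -- images would then lie in two disjoint summands of `N`, and over such a domain any two
      -- arrows agree.
      arrows-injective-at : ∀ {T} (a b : T ⇒ N × (X + Y)) {n m k} →
        IsArrow a n k → IsArrow b m k → π₂ ∘ a ≈ π₂ ∘ b → arrows ∘ a ≈ arrows ∘ b → a ≈ b
      arrows-injective-at a b {n} {m} {k} ia ib q p with n ℕₚ.≟ m
      ... | yes ≡.refl = ≈-trans A.a≈row (≈-trans (_ ∘⟨ q) (≈-sym B.a≈row))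
        where
          module A = IsArrow ia
          module B = IsArrow ib
      ... | no n≢m = inj-disjoint ω (λ eq → n≢m (delay-injective n m k eq)) (begin
        num (delay n k) ∘ !        ≈⟨ number A.arrows∘ ⟨
        π₁ ∘ (arrows ∘ a)          ≈⟨ π₁ ∘⟨ p ⟩
        π₁ ∘ (arrows ∘ b)          ≈⟨ number B.arrows∘ ⟩
        num (delay m k) ∘ !        ∎) a b
        where
          module A = IsArrow ia
          module B = IsArrow ib
          number : ∀ {T d} {c : T ⇒ N × (X + (U + Y))} {z} →
            c ≈ row d ∘ z → π₁ ∘ c ≈ num d ∘ !
          number p = ≈-trans (π₁ ∘⟨ p) (≈-trans (pullˡ π₁∘⟨⟩) (pullʳ !-unique₂))

      arrows-mono : Mono arrows
      arrows-mono a b p = num-ext (π₁ ∘ b) λ m v bv → arrow-ext (a ∘ v) λ n k w ia →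
        -- Sources agree because `ι` is mono, so `b` inherits the settling time found for `a`.
        let q = ≈-trans (_ ∘⟨ assoc) (≈-trans (pullˡ same) (≈-trans assoc (_ ∘⟨ ≈-sym assoc)))
        in arrows-injective-at _ _ ia
          (isArrow (number-∘ w bv) (settles-resp q (IsArrow.settles ia))) q
          (≈-trans (≈-sym assoc) (≈-trans (pullˡ p ⟩∘ w) (≈-trans (assoc ⟩∘ w) assoc)))
        where
          same : π₂ ∘ a ≈ π₂ ∘ b
          same = stateInclusion-mono _ _ (begin
            ι ∘ (π₂ ∘ a)          ≈⟨ assoc ⟨
            (ι ∘ π₂) ∘ a          ≈⟨ pullˡ π₂∘⟨⟩ ⟨
            π₂ ∘ (arrows ∘ a)     ≈⟨ π₂ ∘⟨ p ⟩
            π₂ ∘ (arrows ∘ b)     ≈⟨ pullˡ π₂∘⟨⟩ ⟩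
            (ι ∘ π₂) ∘ b          ≈⟨ assoc ⟩
            ι ∘ (π₂ ∘ b)          ∎)

      -- The equation `eq` is a parameter so that the result applies to whichever proof occurs in
      -- `F₂`.
      arrows-comp :
        let module C = InternalCategory (Trans (loopAutomaton g))
            module D = InternalCategory (Trans (loopAutomaton h)) in
        (eq : π₂ ∘ (arrows ∘ C.C₂.p₁) ≈ 𝕏′.α ∘ (arrows ∘ C.C₂.p₂)) →
        arrows ∘ C.comp ≈ D.comp ∘ D.C₂.universal eq
      arrows-comp eq = begin
        arrows ∘ comp
          ≈⟨ ⟨⟩∘ ⟩
        ⟨ fromRows steps ∘ comp , (ι ∘ π₂) ∘ comp ⟩
          ≈⟨ ⟨⟩-cong (steps-composite C₂.p₁ C₂.p₂ C₂.commute) (pullʳ π₂∘⟨⟩) ⟩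
        ⟨ stepsSum C₂.p₁ C₂.p₂ , ι ∘ (π₂ ∘ C₂.p₂) ⟩
          ≈⟨ ⟨⟩-cong (μN ∘⟨ ⟨⟩-cong (pullˡ π₁∘⟨⟩) (pullˡ π₁∘⟨⟩))
                     (≈-trans (pullˡ π₂∘⟨⟩) assoc) ⟨
        ⟨ μN ∘ ⟨ π₁ ∘ (arrows ∘ C₂.p₁) , π₁ ∘ (arrows ∘ C₂.p₂) ⟩ , π₂ ∘ (arrows ∘ C₂.p₂) ⟩
          ≈⟨ comp∘universal (loopAutomaton h) eq ⟨
        D.comp ∘ D.C₂.universal eq
          ∎
        where
          open InternalCategory (Trans (loopAutomaton g)) using (comp; module C₂)
          module D = InternalCategory (Trans (loopAutomaton h))

      -- Fullness.

      -- A state in the image of `ι` comes from X or Y, and each is disjoint from U; the domain is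
      -- therefore degenerate.
      inclusion-running-disjoint : ∀ {T} {z : T ⇒ X + Y} {u : T ⇒ U} → ι ∘ z ≈ i₂ ∘ (i₁ ∘ u) →
        ∀ {S} (r s : T ⇒ S) → r ≈ s
      inclusion-running-disjoint {z = z} {u} p r s = +-ext z
        (λ v x zv → +-disjoint (begin
          i₁ ∘ x                 ≈⟨ pullˡ inject₁ ⟨
          ι ∘ (i₁ ∘ x)           ≈⟨ ι ∘⟨ zv ⟨
          ι ∘ (z ∘ v)            ≈⟨ pullˡ p ⟩
          (i₂ ∘ (i₁ ∘ u)) ∘ v    ≈⟨ assoc ⟩
          i₂ ∘ ((i₁ ∘ u) ∘ v)    ∎) _ _)
        (λ v y zv → +-disjoint (i₂-mono _ _ (begin
          i₂ ∘ (i₁ ∘ (u ∘ v))    ≈⟨ pullʳ assoc ⟨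
          (i₂ ∘ (i₁ ∘ u)) ∘ v    ≈⟨ pullˡ p ⟨
          ι ∘ (z ∘ v)            ≈⟨ ι ∘⟨ zv ⟩
          ι ∘ (i₂ ∘ y)           ≈⟨ pullˡ inject₂ ⟩
          (i₂ ∘ i₂) ∘ y          ≈⟨ assoc ⟩
          i₂ ∘ (i₂ ∘ y)          ∎)) _ _)

      arrows-cover : ∀ {T S} (a : T ⇒ N × (X + (U + Y))) (z z′ : T ⇒ X + Y) →
        π₂ ∘ a ≈ ι ∘ z → 𝕏′.α ∘ a ≈ ι ∘ z′ → {r s : T ⇒ S} →
        (∀ {V} (v : V ⇒ T) (x : V ⇒ N × (X + Y)) → a ∘ v ≈ arrows ∘ x → r ∘ v ≈ s ∘ v) →
        r ≈ s
      -- The pair of `π₁ ∘ a` and `z` serves only to split into cases: its numeral `n` counts steps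
      -- of `h`, not of `g`, so it must still be recognized as a delay.
      arrows-cover {T} a z z′ src tgt {r} {s} p = arrow-ext ⟨ π₁ ∘ a , z ⟩
        λ n k v ia → at v ia (delayView k n)
        where
          at : ∀ {n k V} (v : V ⇒ T) →
            IsArrow (⟨ π₁ ∘ a , z ⟩ ∘ v) n k → DelayView k n → r ∘ v ≈ s ∘ v
          at {n} {k} v ia = by
            where
              open IsArrow ia
              settles-z : Settles (z ∘ v) k
              settles-z = settles-resp (pullˡ π₂∘⟨⟩) settles
              a∘v : a ∘ v ≈ row n ∘ (ι ∘ (z ∘ v))
              a∘v = begin
                a ∘ v                              ≈⟨ ⟨π₁∘,π₂∘⟩ ⟨
                ⟨ π₁ ∘ (a ∘ v) , π₂ ∘ (a ∘ v) ⟩    ≈⟨ ⟨⟩-cong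
                  (≈-trans (≈-sym assoc) (≈-trans (≈-sym (pullˡ π₁∘⟨⟩)) number))
                  (≈-trans (pullˡ src) assoc) ⟩
                ⟨ num n ∘ ! , ι ∘ (z ∘ v) ⟩        ≈⟨ ⟨num,⟩ n _ ⟩
                row n ∘ (ι ∘ (z ∘ v))              ∎
              by : DelayView k n → r ∘ v ≈ s ∘ v
              -- Undoing the delay gives the preimage: `n′` steps of `g` from the same source.
              by (delayed n′) = p v preimage (begin
                a ∘ v                                       ≈⟨ a∘v ⟩
                row (delay n′ k) ∘ (ι ∘ (z ∘ v))            ≈⟨ _ ∘⟨ (ι ∘⟨ π₂∘preimage) ⟨
                row (delay n′ k) ∘ (ι ∘ (π₂ ∘ preimage))    ≈⟨ IsArrow.arrows∘ preimage-isArrow ⟨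
                arrows ∘ preimage                           ∎)
                where
                  preimage = row n′ ∘ (z ∘ v)
                  π₂∘preimage : π₂ ∘ preimage ≈ z ∘ v
                  π₂∘preimage = ≈-trans (pullˡ π₂∘⟨⟩) identityˡ
                  preimage-isArrow : IsArrow preimage n′ k
                  preimage-isArrow = isArrow
                    (≈-trans (pullˡ π₁∘⟨⟩) (pullʳ !-unique₂))
                    (settles-resp (≈-sym π₂∘preimage) settles-z)
              -- After `suc j` steps, at most `k`, the run is still in U, whereas the target of `a`
              -- lies in the image of `ι`.
              by (early {j} j<k) = let u , q = Settles.running settles-z j<k in
                inclusion-running-disjoint (begin
                  ι ∘ (z′ ∘ v)                           ≈⟨ pullˡ (≈-sym tgt) ⟩
                  (𝕏′.α ∘ a) ∘ v                         ≈⟨ pullʳ a∘v ⟩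
                  𝕏′.α ∘ (row (suc j) ∘ (ι ∘ (z ∘ v)))   ≈⟨ pullˡ (fromRows∘row (h ^_) (suc j)) ⟩
                  (h ^ suc j) ∘ (ι ∘ (z ∘ v))            ≈⟨ q ⟩
                  i₂ ∘ (i₁ ∘ u)                          ∎) _ _

theorem28 : ∀ {o ℓ e} {𝔈 : Category o ℓ e} (L : CountablyLextensive 𝔈) →
    let open Category 𝔈
        open Lextensive L
        open Iteration in
    ∀ {X U Y : Obj} (f : X + U ⇒ U + Y) (t : Terminating f) →
    Σ[ F ∈ Refinement (loopAutomaton (calledLoop f t)) (loopAutomaton (processorLoop f)) ]
      Refinement.F₀ F ≈ stateInclusion
theorem28 {𝔈 = 𝔈} L f t = refinement L
  (record
    { F₀     = Lextensive.stateInclusion L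
    ; F₁     = arrows L f t
    ; F-∂₀   = Lextensive.π₂∘⟨⟩ L
    ; F-∂₁   = arrows-∂₁ L f t
    ; F-ide  = arrows-ide L f t
    ; F-comp = arrows-comp L f t _
    })
  (stateInclusion-mono L) (arrows-mono L f t) (arrows-cover L f t) , Category.≈-refl 𝔈
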